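{- Let $i\ge 0$ be an integer and let $p:\mathbb{N}\to[0,1]$, $n\mapsto p_n$, be middling of exponent $2i$. Then $$\lim_{n\to\infty}\ \mathbb{P}_{\Gamma\in\Omega^{[n]}_{p_n}}\Big(\kappa^i_{\mathbb{F}_2}(\Gamma)\le\delta^i(\Gamma)\Big)=1 .$$
   Context: Graphs are finite and simple, $\Gamma=(V(\Gamma),E(\Gamma))$. $\mathbb{N}=\{1,2,\dots\}$ and $[n]=\{1,\dots,n\}$. $\Omega^{[n]}_{p}$ denotes the Erdős–Rényi probability space of random graphs on vertex set $[n]$ in which each of the $\binom n2$ possible edges is present independently with probability $p$. A function $p:\mathbb{N}\to[0,1]$ is middling of exponent $w$ if $-\liminf_{n\to\infty}\log_n p_n<w^{ -1}$ and $\lim_{n\to\infty}p_n=0$. (For $w=0$ read $w^{ -1}=+\infty$.) For $C\subseteq V(\Gamma)$, $\Gamma-C$ is the subgraph of $\Gamma$ induced on $V(\Gamma)\setminus C$. For a vertex $v$, $N_\Gamma(v)=\{u:\{u,v\}\in E(\Gamma)\}$, and for a vertex set $I$, $N_\Gamma(I)=\bigcap_{c\in I}N_\Gamma(c)$ is the set of common neighbors. $\mathrm{Cl}(\Gamma)$ is the clique complex of $\Gamma$: the simplicial complex on $V(\Gamma)$ whose set of $i$-simplices $\mathrm{Cl}(\Gamma)[i]$ consists of the $(i+1)$-element vertex subsets that are pairwise adjacent. For a field $\mathbb{K}$ and an integer $i\ge 0$, $$\kappa^i_{\mathbb{K}}(\Gamma)=\min\{|C| : C\subseteq V(\Gamma),\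 \tilde H^i(\mathrm{Cl}(\Gamma-C);\mathbb{K})\ne 0\},$$ $$\delta^i(\Gamma)=\min\{|N_\Gamma(I)| : I\in \mathrm{Cl}(\Gamma)[i]\},$$ where $\tilde H^i$ is reduced simplicial cohomology and the minimum over the empty set is $+\infty$. $\mathbb{F}_2$ is the field with two elements. -}

module Defs where

open import Algebra.Bundles using (CommutativeRing)
open import Data.Bool.Base using (Bool; true; false; T)
import Data.Bool.Properties as Bool
open import Data.Fin.Base using (Fin; zero; suc)
import Data.Fin.Properties as Fin
open import Data.Fin.Subset
  using (Subset; inside; outside; ∣_∣; _∈_; _∉_; _⊆_; _─_; ⊤; ⊥)
open import Data.Fin.Subset.Properties
  using (_∈?_; _⊆?_; anySubset?; ⊆-trans; ⊆-min; ∉⊥; ∈⊤; x∈p∧x∉q⇒x∈p─q)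
open import Data.Integer.Base as ℤ using (+_; -[1+_])
open import Data.List.Base using (List; []; _∷_; _++_; map; filter; foldr; cartesianProductWith)
import Data.List.Extrema as Extrema
open import Data.List.Properties using (map-cong)
open import Data.Nat.Base as ℕ using (ℕ; zero; suc)
import Data.Nat.Properties as ℕ
open import Data.Product.Base using (∃-syntax; _×_; _,_)
open import Data.Rational.Base as ℚ using (ℚ; 0ℚ; 1ℚ; ½; ↥_; ↧ₙ_)
import Data.Rational.Properties as ℚ
open import Data.Rational.Solver using (module +-*-Solver)
open import Data.Vec.Base as Vec using ([]; _∷_)
open import Function.Base using (_∘_)
open import Level using (Level; _⊔_; 0ℓ)
open import Relation.Binary.Bundles using (TotalOrder)
open import Relation.Binary.Core using (Rel)
import Relation.Binary.Construct.Add.Supremum.NonStrict as AddSup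
import Relation.Binary.Definitions as B
open import Relation.Binary.PropositionalEquality
  using (_≡_; _≢_; _≗_; refl; sym; trans; cong; subst; subst₂)
open import Relation.Nullary.Construct.Add.Supremum using (_⁺; ⊤⁺; [_])
open import Relation.Nullary.Decidable
  using (Dec; yes; no; does; T?; ¬?; _×-dec_; _→-dec_; map′; decidable-stable)
open import Relation.Nullary.Negation using (¬_)
open import Relation.Unary using (Pred; Decidable)

private variable
  a c ℓ : Level
  n : ℕ

------------------------------------------------------------------------
-- Real numbers: Cauchy sequences of rationals.  Two sequences denote the
-- same real when x ≤ᴿ y and y ≤ᴿ x; everything below respects this.

IsCauchy : (ℕ → ℚ) → Set
IsCauchy x = ∀ ε → 0ℚ ℚ.< ε →
  ∃[ N ] (∀ j k → N ℕ.≤ j → N ℕ.≤ k → ℚ.∣ x j ℚ.- x k ∣ ℚ.< ε)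

record ℝ : Set where
  constructor mkℝ
  field
    approx : ℕ → ℚ
    cauchy : IsCauchy approx

open ℝ public

private
  0<½ε : ∀ {ε} → 0ℚ ℚ.< ε → 0ℚ ℚ.< ½ ℚ.* ε
  0<½ε {ε} 0<ε = subst (ℚ._< ½ ℚ.* ε) (ℚ.*-zeroʳ ½) (ℚ.*-monoʳ-<-pos ½ 0<ε)

  ½ε+½ε : ∀ ε → ½ ℚ.* ε ℚ.+ ½ ℚ.* ε ≡ ε
  ½ε+½ε ε = trans (sym (ℚ.*-distribʳ-+ ε ½ ½)) (ℚ.*-identityˡ ε)

  const-cauchy : ∀ q → IsCauchy (λ _ → q)
  const-cauchy q ε 0<ε = 0 , λ _ _ _ _ →
    subst (λ z → ℚ.∣ z ∣ ℚ.< ε) (sym (ℚ.+-inverseʳ q)) 0<ε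

  neg-cauchy : ∀ {x} → IsCauchy x → IsCauchy (λ k → ℚ.- x k)
  neg-cauchy {x} cx ε 0<ε with cx ε 0<ε
  ... | N , h = N , λ j k N≤j N≤k →
    subst (ℚ._< ε)
      (trans (sym (ℚ.∣-p∣≡∣p∣ (x j ℚ.- x k))) (cong ℚ.∣_∣ (ℚ.neg-distrib-+ (x j) (ℚ.- x k))))
      (h j k N≤j N≤k)

  +-cauchy : ∀ {x y} → IsCauchy x → IsCauchy y → IsCauchy (λ k → x k ℚ.+ y k)
  +-cauchy {x} {y} cx cy ε 0<ε with cx (½ ℚ.* ε) (0<½ε 0<ε) | cy (½ ℚ.* ε) (0<½ε 0<ε)
  ... | N , f | M , g = N ℕ.⊔ M , λ j k NM≤j NM≤k →
    subst₂ ℚ._<_ refl (½ε+½ε ε)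
      (ℚ.≤-<-trans
        (subst (λ z → ℚ.∣ z ∣ ℚ.≤ ℚ.∣ x j ℚ.- x k ∣ ℚ.+ ℚ.∣ y j ℚ.- y k ∣)
          (swap (x j) (x k) (y j) (y k))
          (ℚ.∣p+q∣≤∣p∣+∣q∣ (x j ℚ.- x k) (y j ℚ.- y k)))
        (ℚ.+-mono-<
          (f j k (ℕ.m⊔n≤o⇒m≤o N M NM≤j) (ℕ.m⊔n≤o⇒m≤o N M NM≤k))
          (g j k (ℕ.m⊔n≤o⇒n≤o N M NM≤j) (ℕ.m⊔n≤o⇒n≤o N M NM≤k))))
    where
    open +-*-Solver
    swap : ∀ p q r s → (p ℚ.- q) ℚ.+ (r ℚ.- s) ≡ (p ℚ.+ r) ℚ.- (q ℚ.+ s)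
    swap = solve 4 (λ p q r s → (p :- q) :+ (r :- s) := (p :+ r) :- (q :+ s)) refl

  eventually-bounded : ∀ {x} → IsCauchy x →
    ∃[ A ] (0ℚ ℚ.< A × ∃[ N ] (∀ k → N ℕ.≤ k → ℚ.∣ x k ∣ ℚ.≤ A))
  eventually-bounded {x} cx with cx 1ℚ (ℚ.positive⁻¹ 1ℚ)
  ... | N , h = 1ℚ ℚ.+ ℚ.∣ x N ∣
              , ℚ.+-mono-<-≤ (ℚ.positive⁻¹ 1ℚ) (ℚ.0≤∣p∣ (x N))
              , N , λ k N≤k →
    ℚ.≤-trans
      (subst (λ z → ℚ.∣ z ∣ ℚ.≤ ℚ.∣ x k ℚ.- x N ∣ ℚ.+ ℚ.∣ x N ∣)
        (cancel (x k) (x N)) (ℚ.∣p+q∣≤∣p∣+∣q∣ (x k ℚ.- x N) (x N)))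
      (ℚ.+-monoˡ-≤ ℚ.∣ x N ∣ (ℚ.<⇒≤ (h k N N≤k ℕ.≤-refl)))
    where
    open +-*-Solver
    cancel : ∀ p q → (p ℚ.- q) ℚ.+ q ≡ p
    cancel = solve 2 (λ p q → (p :- q) :+ q := p) refl

  shrink : ∀ A ε → 0ℚ ℚ.< A → 0ℚ ℚ.< ε →
    ∃[ δ ] (0ℚ ℚ.< δ × (∀ p q → ℚ.∣ p ∣ ℚ.≤ A → ℚ.∣ q ∣ ℚ.< δ → ℚ.∣ p ℚ.* q ∣ ℚ.< ε))
  shrink A ε 0<A 0<ε = δ , 0<δ , λ p q p≤A q<δ →
    subst₂ ℚ._<_ (sym (ℚ.∣p*q∣≡∣p∣*∣q∣ p q)) Aδ≡ε
      (ℚ.≤-<-trans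
        (ℚ.*-monoʳ-≤-nonNeg ℚ.∣ q ∣ {{ℚ.∣-∣-nonNeg q}} p≤A)
        (ℚ.*-monoʳ-<-pos A q<δ))
    where
    instance
      A⁺ = ℚ.positive 0<A
      A≢0 = ℚ.pos⇒nonZero A
      A⁻¹⁺ = ℚ.1/pos⇒pos A
    δ = ℚ.1/ A ℚ.* ε
    0<δ : 0ℚ ℚ.< δ
    0<δ = subst (ℚ._< δ) (ℚ.*-zeroʳ (ℚ.1/ A)) (ℚ.*-monoʳ-<-pos (ℚ.1/ A) 0<ε)
    Aδ≡ε : A ℚ.* δ ≡ ε
    Aδ≡ε = trans (sym (ℚ.*-assoc A (ℚ.1/ A) ε))
          (trans (cong (ℚ._* ε) (ℚ.*-inverseʳ A)) (ℚ.*-identityˡ ε))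

  product-close : ∀ ε p q r s →
    ℚ.∣ p ℚ.* (r ℚ.- s) ∣ ℚ.< ½ ℚ.* ε → ℚ.∣ s ℚ.* (p ℚ.- q) ∣ ℚ.< ½ ℚ.* ε →
    ℚ.∣ p ℚ.* r ℚ.- q ℚ.* s ∣ ℚ.< ε
  product-close ε p q r s h₁ h₂ =
    subst₂ ℚ._<_ (cong ℚ.∣_∣ (split p q r s)) (½ε+½ε ε)
      (ℚ.≤-<-trans (ℚ.∣p+q∣≤∣p∣+∣q∣ (p ℚ.* (r ℚ.- s)) (s ℚ.* (p ℚ.- q)))
        (ℚ.+-mono-< h₁ h₂))
    where
    open +-*-Solver
    split : ∀ p q r s → p ℚ.* (r ℚ.- s) ℚ.+ s ℚ.* (p ℚ.- q) ≡ p ℚ.* r ℚ.- q ℚ.* s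
    split = solve 4 (λ p q r s → p :* (r :- s) :+ s :* (p :- q) := p :* r :- q :* s) refl

  *-cauchy : ∀ {x y} → IsCauchy x → IsCauchy y → IsCauchy (λ k → x k ℚ.* y k)
  *-cauchy {x} {y} cx cy ε 0<ε =
    let (A , 0<A , K , x≤A) = eventually-bounded cx
        (B , 0<B , L , y≤B) = eventually-bounded cy
        (δ , 0<δ , xd) = shrink A (½ ℚ.* ε) 0<A (0<½ε 0<ε)
        (η , 0<η , yd) = shrink B (½ ℚ.* ε) 0<B (0<½ε 0<ε)
        (M , g) = cy δ 0<δ
        (N , f) = cx η 0<η
    in (K ℕ.⊔ L) ℕ.⊔ (M ℕ.⊔ N) , λ j k Z≤j Z≤k →
      let KL≤j = ℕ.m⊔n≤o⇒m≤o (K ℕ.⊔ L) (M ℕ.⊔ N) Z≤j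
          KL≤k = ℕ.m⊔n≤o⇒m≤o (K ℕ.⊔ L) (M ℕ.⊔ N) Z≤k
          MN≤j = ℕ.m⊔n≤o⇒n≤o (K ℕ.⊔ L) (M ℕ.⊔ N) Z≤j
          MN≤k = ℕ.m⊔n≤o⇒n≤o (K ℕ.⊔ L) (M ℕ.⊔ N) Z≤k
      in product-close ε (x j) (x k) (y j) (y k)
        (xd (x j) (y j ℚ.- y k) (x≤A j (ℕ.m⊔n≤o⇒m≤o K L KL≤j))
          (g j k (ℕ.m⊔n≤o⇒m≤o M N MN≤j) (ℕ.m⊔n≤o⇒m≤o M N MN≤k)))
        (yd (y k) (x j ℚ.- x k) (y≤B k (ℕ.m⊔n≤o⇒n≤o K L KL≤k))
          (f j k (ℕ.m⊔n≤o⇒n≤o M N MN≤j) (ℕ.m⊔n≤o⇒n≤o M N MN≤k)))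

fromℚ : ℚ → ℝ
fromℚ q = mkℝ (λ _ → q) (const-cauchy q)

fromℕ : ℕ → ℝ
fromℕ k = fromℚ (+ k ℚ./ 1)

0ᴿ 1ᴿ : ℝ
0ᴿ = fromℚ 0ℚ
1ᴿ = fromℚ 1ℚ

infix  8 -ᴿ_
infixr 8 _^ᴿ_
infixl 7 _*ᴿ_
infixl 6 _+ᴿ_ _-ᴿ_
infix  4 _<ᴿ_ _≤ᴿ_

_+ᴿ_ _*ᴿ_ : ℝ → ℝ → ℝ
x +ᴿ y = mkℝ (λ k → approx x k ℚ.+ approx y k) (+-cauchy {approx x} {approx y} (cauchy x) (cauchy y))
x *ᴿ y = mkℝ (λ k → approx x k ℚ.* approx y k) (*-cauchy {approx x} {approx y} (cauchy x) (cauchy y))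

-ᴿ_ : ℝ → ℝ
-ᴿ x = mkℝ (λ k → ℚ.- approx x k) (neg-cauchy {approx x} (cauchy x))

_-ᴿ_ : ℝ → ℝ → ℝ
x -ᴿ y = x +ᴿ (-ᴿ y)

_^ᴿ_ : ℝ → ℕ → ℝ
x ^ᴿ zero  = 1ᴿ
x ^ᴿ suc k = x *ᴿ x ^ᴿ k

sumᴿ : List ℝ → ℝ
sumᴿ = foldr _+ᴿ_ 0ᴿ

_≤ᴿ_ _<ᴿ_ : ℝ → ℝ → Set
x ≤ᴿ y = ∀ ε → 0ℚ ℚ.< ε →
  ∃[ N ] (∀ k → N ℕ.≤ k → approx x k ℚ.≤ approx y k ℚ.+ ε)
x <ᴿ y = ∃[ ε ] (0ℚ ℚ.< ε ×
  ∃[ N ] (∀ k → N ℕ.≤ k → approx x k ℚ.+ ε ℚ.≤ approx y k))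

Eventually : (ℕ → Set) → Set
Eventually P = ∃[ N ] (∀ n → N ℕ.≤ n → P n)

lim : (ℕ → ℝ) → ℝ → Set
lim x L = ∀ ε → 0ℚ ℚ.< ε →
  Eventually (λ n → (L -ᴿ fromℚ ε <ᴿ x n) × (x n <ᴿ L +ᴿ fromℚ ε))

------------------------------------------------------------------------
-- Extended reals as lower cuts: L : ExtReal stands for the element of
-- [-∞,+∞] with  L q  iff  q < L.  Logarithms live here because p n may
-- vanish, and the limit inferior because it may be infinite.

ExtReal : Set₁
ExtReal = ℚ → Set

-- For n ≥ 2 and x ≥ 0, writing q = a / b with b > 0:
-- q < log_n x  iff  n ^ a < x ^ b; a negative power of n is moved to the
-- other side.  In particular log_n 0 = -∞ (the empty cut).
log : ℕ → ℝ → ExtReal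
log n x q with ↥ q
... | + a       = fromℕ (n ℕ.^ a) <ᴿ x ^ᴿ ↧ₙ q
... | -[1+ a ]  = 1ᴿ <ᴿ fromℕ (n ℕ.^ suc a) *ᴿ x ^ᴿ ↧ₙ q

-- q < liminf Lₙ  iff  some q′ > q satisfies q′ < Lₙ for all large n.
liminf : (ℕ → ExtReal) → ExtReal
liminf L q = ∃[ q′ ] (q ℚ.< q′ × Eventually (λ n → L n q′))

-- w⁻¹, with 0⁻¹ = +∞.
recip : ℕ → ℚ ⁺
recip zero    = ⊤⁺
recip (suc w) = [ + 1 ℚ./ suc w ]

infix 4 -_<ᴱ_

-- -L < r  iff  -r < L; -L < +∞  iff  L ≠ -∞.
-_<ᴱ_ : ExtReal → ℚ ⁺ → Set
- L <ᴱ [ r ] = L (ℚ.- r)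
- L <ᴱ ⊤⁺    = ∃[ q ] L q

UnitIntervalValued : (ℕ → ℝ) → Set
UnitIntervalValued p = ∀ n → 1 ℕ.≤ n → (0ᴿ ≤ᴿ p n) × (p n ≤ᴿ 1ᴿ)

Middling : ℕ → (ℕ → ℝ) → Set
Middling w p = (- liminf (λ n → log n (p n)) <ᴱ recip w) × lim p 0ᴿ

------------------------------------------------------------------------

⟦_⟧ : {P : Pred (Fin n) a} → Decidable P → Subset n
⟦ P? ⟧ = Vec.tabulate (does ∘ P?)

subsets : ∀ n → List (Subset n)
subsets zero    = [] ∷ []
subsets (suc n) = map (inside ∷_) (subsets n) ++ map (outside ∷_) (subsets n)

allSubsets? : {P : Pred (Subset n) a} → Decidable P → Dec (∀ σ → P σ)
allSubsets? P? = map′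
  (λ ¬∃¬ σ → decidable-stable (P? σ) (λ ¬p → ¬∃¬ (σ , ¬p)))
  (λ ∀p (σ , ¬p) → ¬p (∀p σ))
  (¬? (anySubset? (¬? ∘ P?)))

ℕ∞ : Set
ℕ∞ = ℕ ⁺

open AddSup ℕ._≤_ public using () renaming (_≤⁺_ to _≤∞_)

_≤∞?_ : B.Decidable _≤∞_
_≤∞?_ = AddSup.≤⁺-dec ℕ._≤_ ℕ._≤?_

≤∞-totalOrder : TotalOrder 0ℓ 0ℓ 0ℓ
≤∞-totalOrder = record
  { isTotalOrder = AddSup.≤⁺-isTotalOrder-≡ ℕ._≤_ ℕ.≤-isTotalOrder }

min∞ : List ℕ → ℕ∞
min∞ ks = Extrema.min ≤∞-totalOrder ⊤⁺ (map [_] ks)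

------------------------------------------------------------------------
-- The vertex set of a graph is a subset V of a fixed Fin N, so that Γ − C
-- lives over the same Fin N as Γ.

record Graph (N : ℕ) : Set₁ where
  field
    V          : Subset N
    Adj        : Rel (Fin N) 0ℓ
    adj?       : B.Decidable Adj
    adj-sym    : ∀ {u v} → Adj u v → Adj v u
    adj-irrefl : ∀ {v} → ¬ Adj v v
    adj-in-V   : ∀ {u v} → Adj u v → u ∈ V

infixl 6 _−_

_−_ : ∀ {N} → Graph N → Subset N → Graph N
Γ − C = record
  { V          = V ─ C
  ; Adj        = λ u v → Adj u v × u ∉ C × v ∉ C
  ; adj?       = λ u v → adj? u v ×-dec ¬? (u ∈? C) ×-dec ¬? (v ∈? C)
  ; adj-sym    = λ (uv , u∉C , v∉C) → adj-sym uv , v∉C , u∉C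
  ; adj-irrefl = λ (vv , _) → adj-irrefl vv
  ; adj-in-V   = λ (uv , u∉C , _) → x∈p∧x∉q⇒x∈p─q (adj-in-V uv) u∉C
  } where open Graph Γ

Nbhd : ∀ {N} → Graph N → Fin N → Subset N
Nbhd Γ v = ⟦ (λ u → Graph.adj? Γ v u) ⟧

-- Common neighbours (only used for nonempty I).
CommonNbhd : ∀ {N} → Graph N → Subset N → Subset N
CommonNbhd Γ I = ⟦ (λ u → Fin.all? λ c → c ∈? I →-dec u ∈? Nbhd Γ c) ⟧

------------------------------------------------------------------------
-- Simplicial complexes; simplices are identified with their vertex sets
-- and the empty simplex (of dimension -1) is included.

record SimplicialComplex (N : ℕ) : Set₁ where
  field
    Simplex   : Pred (Subset N) 0ℓ
    simplex?  : Decidable Simplex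
    ∅-simplex : Simplex ⊥
    ⊆-closed  : ∀ {σ τ} → σ ⊆ τ → Simplex τ → Simplex σ

  -- i-dimensional simplices are those with k = i + 1 vertices.
  OfCard : ℕ → Pred (Subset N) 0ℓ
  OfCard k σ = Simplex σ × ∣ σ ∣ ≡ k

  ofCard? : ∀ k → Decidable (OfCard k)
  ofCard? k σ = simplex? σ ×-dec ∣ σ ∣ ℕ.≟ k

Cl : ∀ {N} → Graph N → SimplicialComplex N
Cl Γ = record
  { Simplex   = λ σ → σ ⊆ V × (∀ u v → u ∈ σ → v ∈ σ → u ≢ v → Adj u v)
  ; simplex?  = λ σ → σ ⊆? V ×-dec
      Fin.all? λ u → Fin.all? λ v →
        u ∈? σ →-dec v ∈? σ →-dec ¬? (u Fin.≟ v) →-dec adj? u v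
  ; ∅-simplex = ⊆-min V , λ _ _ u∈⊥ → λ _ _ → contra u∈⊥
  ; ⊆-closed  = λ {σ} {τ} σ⊆τ (τ⊆V , clique) →
      ⊆-trans {i = σ} {j = τ} {k = V} σ⊆τ τ⊆V
      , λ u v u∈σ v∈σ → clique u v (σ⊆τ u∈σ) (σ⊆τ v∈σ)
  } where
    open Graph Γ
    contra : ∀ {u v : Fin _} → u ∈ ⊥ → Adj u v
    contra u∈⊥ with () ← ∉⊥ u∈⊥

------------------------------------------------------------------------

-- σ ∖ v₀, σ ∖ v₁, … for σ = {v₀ < v₁ < …}.
facets : Subset n → List (Subset n)
facets []            = []
facets (inside  ∷ σ) = (outside ∷ σ) ∷ map (inside ∷_) (facets σ)
facets (outside ∷ σ) = map (outside ∷_) (facets σ)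

module Cohomology (K : CommutativeRing c ℓ) where
  open CommutativeRing K hiding (zero)

  -- x₀ - x₁ + x₂ - …
  altSum : List Carrier → Carrier
  altSum = foldr _-_ 0#

  -- An i-cochain of X is given by a function on all subsets of which only
  -- the values on the i-simplices of X matter.  Since every face of a
  -- simplex is a simplex, the coboundary can be written down uniformly.
  Cochain : ℕ → Set c
  Cochain N = Subset N → Carrier

  d : Cochain n → Cochain n
  d f σ = altSum (map f (facets σ))

  module _ {N} (X : SimplicialComplex N) (i : ℕ) where
    open SimplicialComplex X

    IsCocycle : Cochain N → Set ℓ
    IsCocycle f = ∀ σ → OfCard (2 ℕ.+ i) σ → d f σ ≈ 0#

    -- f agrees on the i-simplices with d g for an (i-1)-cochain g; for
    -- i = 0, g lives on the empty simplex, so this is reduced cohomology.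
    IsCoboundary : Cochain N → Set (c ⊔ ℓ)
    IsCoboundary f = ∃[ g ] (∀ σ → OfCard (1 ℕ.+ i) σ → f σ ≈ d g σ)

    H̃≢0 : Set (c ⊔ ℓ)
    H̃≢0 = ∃[ f ] (IsCocycle f × ¬ IsCoboundary f)

open Cohomology using (H̃≢0)

𝔽₂ : CommutativeRing 0ℓ 0ℓ
𝔽₂ = Bool.xor-∧-commutativeRing

module _ where
  open Cohomology 𝔽₂ hiding (H̃≢0)

  private
    join : (Subset n → Bool) → (Subset n → Bool) → Subset (suc n) → Bool
    join g h (inside  ∷ σ) = g σ
    join g h (outside ∷ σ) = h σ

    anyCochain? : {P : Pred (Subset n → Bool) a} →
      (∀ {f g} → f ≗ g → P f → P g) → Decidable P → Dec (∃[ f ] P f)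
    anyCochain? {n = zero} {P = P} resp P? with P? (λ _ → true) | P? (λ _ → false)
    ... | yes p | _     = yes (_ , p)
    ... | no _  | yes p = yes (_ , p)
    ... | no ¬t | no ¬f = no λ (f , p) → absurd f p (f []) refl
      where
      absurd : ∀ f → P f → ∀ b → ¬ f [] ≡ b
      absurd f p true  eq = ¬t (resp (λ { [] → eq }) p)
      absurd f p false eq = ¬f (resp (λ { [] → eq }) p)
    anyCochain? {n = suc n} {P = P} resp P? = map′
      (λ (g , h , p) → join g h , p)
      (λ (f , p) → f ∘ (inside ∷_) , f ∘ (outside ∷_) ,
        resp (λ { (inside ∷ _) → refl ; (outside ∷ _) → refl }) p)
      (anyCochain?
        (λ g≗g′ (h , p) → h , resp (λ { (inside ∷ σ) → g≗g′ σ ; (outside ∷ _) → refl }) p)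
        (λ g → anyCochain?
          (λ h≗h′ → resp (λ { (inside ∷ _) → refl ; (outside ∷ σ) → h≗h′ σ }))
          (λ h → P? (join g h))))

    d-cong : {f g : Cochain n} → f ≗ g → d f ≗ d g
    d-cong f≗g σ = cong altSum (map-cong f≗g (facets σ))

  H̃≢0-𝔽₂? : ∀ {N} (X : SimplicialComplex N) i → Dec (H̃≢0 𝔽₂ X i)
  H̃≢0-𝔽₂? X i = anyCochain?
    (λ f≗g (cocycle , ¬cobdry) →
      (λ σ s → trans (sym (d-cong f≗g σ)) (cocycle σ s)) ,
      (λ (h , eq) → ¬cobdry (h , λ σ s → trans (f≗g σ) (eq σ s))))
    (λ f →
      (allSubsets? λ σ → ofCard? (2 ℕ.+ i) σ →-dec d f σ Bool.≟ false)
      ×-dec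
      ¬? (anyCochain?
        (λ g≗g′ eq σ s → trans (eq σ s) (d-cong g≗g′ σ))
        (λ g → allSubsets? λ σ → ofCard? (1 ℕ.+ i) σ →-dec f σ Bool.≟ d g σ)))
    where open SimplicialComplex X

------------------------------------------------------------------------

-- nonzero? only serves to make the set over which κ minimises decidable;
-- the value does not depend on it.
module _ (K : CommutativeRing c ℓ)
         (nonzero? : ∀ {N} (X : SimplicialComplex N) i → Dec (H̃≢0 K X i)) where

  κ[_] : ∀ {N} → ℕ → Graph N → ℕ∞
  κ[_] {N} i Γ = min∞ (map ∣_∣
    (filter (λ C → C ⊆? Graph.V Γ ×-dec nonzero? (Cl (Γ − C)) i) (subsets N)))

κ-𝔽₂ : ∀ {N} → ℕ → Graph N → ℕ∞
κ-𝔽₂ = κ[_] 𝔽₂ H̃≢0-𝔽₂?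

δ : ∀ {N} → ℕ → Graph N → ℕ∞
δ {N} i Γ = min∞ (map (∣_∣ ∘ CommonNbhd Γ)
  (filter (SimplicialComplex.ofCard? (Cl Γ) (suc i)) (subsets N)))

------------------------------------------------------------------------

-- A simple graph on n labelled vertices, stored as half of its adjacency
-- matrix: Γ ▹ S adds to Γ a new vertex, numbered zero, adjacent exactly to
-- the old vertices in S.  Each pair of vertices is recorded once.
data Ω : ℕ → Set where
  ∅   : Ω 0
  _▹_ : Ω n → Subset n → Ω (suc n)

adjacent : Ω n → Fin n → Fin n → Bool
adjacent (Γ ▹ S) zero    zero    = false
adjacent (Γ ▹ S) zero    (suc v) = Vec.lookup S v
adjacent (Γ ▹ S) (suc u) zero    = Vec.lookup S u
adjacent (Γ ▹ S) (suc u) (suc v) = adjacent Γ u v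

private
  adjacent-sym : (Γ : Ω n) → ∀ u v → adjacent Γ u v ≡ adjacent Γ v u
  adjacent-sym (Γ ▹ S) zero    zero    = refl
  adjacent-sym (Γ ▹ S) zero    (suc v) = refl
  adjacent-sym (Γ ▹ S) (suc u) zero    = refl
  adjacent-sym (Γ ▹ S) (suc u) (suc v) = adjacent-sym Γ u v

  adjacent-irrefl : (Γ : Ω n) → ∀ v → ¬ T (adjacent Γ v v)
  adjacent-irrefl (Γ ▹ S) (suc v) = adjacent-irrefl Γ v

graph : Ω n → Graph n
graph Γ = record
  { V          = ⊤
  ; Adj        = λ u v → T (adjacent Γ u v)
  ; adj?       = λ u v → T? (adjacent Γ u v)
  ; adj-sym    = λ {u} {v} → subst T (adjacent-sym Γ u v)
  ; adj-irrefl = λ {v} → adjacent-irrefl Γ v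
  ; adj-in-V   = λ _ → ∈⊤
  }

outcomes : ∀ n → List (Ω n)
outcomes zero    = ∅ ∷ []
outcomes (suc n) = cartesianProductWith _▹_ (outcomes n) (subsets n)

-- Weight of a set of present edges among a set of possible ones: a factor
-- p for each edge present and 1 - p for each edge absent.
bernoulli : ℝ → Subset n → ℝ
bernoulli p []            = 1ᴿ
bernoulli p (inside  ∷ S) = p *ᴿ bernoulli p S
bernoulli p (outside ∷ S) = (1ᴿ -ᴿ p) *ᴿ bernoulli p S

weight : ℝ → Ω n → ℝ
weight p ∅       = 1ᴿ
weight p (Γ ▹ S) = bernoulli p S *ᴿ weight p Γ

ℙ : ∀ n → ℝ → {E : Pred (Ω n) a} → Decidable E → ℝ
ℙ n p E? = sumᴿ (map (weight p) (filter E? (outcomes n)))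

-- With high probability every vertex b and every list of 2i other vertices
-- admit a vertex u that is adjacent to the whole list, but not to b.  In a graph
-- with this extension property let I = {v₀, …, vᵢ} be a simplex of the clique
-- complex and C the set of its common neighbours.  Replace the vertices of I one
-- at a time: u_j is adjacent to all v_k and to all current vertices with k ≠ j
-- (2i conditions), but not to v_j.  The result is a cross-polytope in Γ - C with
-- I as one of its facets.  As I is maximal in Γ - C, the function "σ contains I"
-- is a cocycle, and it sums to 1 over the facets of the cross-polytope, whereas a
-- coboundary sums to 0.  Hence κ ≤ |C|.
--
-- For fixed b and m = 2i vertices the extension fails with probability at most
-- (1 - q^m (1 - q))^(n - m - 1), and there are at most n^(m + 1) choices.  If
-- q ≤ ½ and n^a q^b ≥ 1 for some a, b with ma < b, which is what middling of
-- exponent m provides, then Bernoulli's inequality turns the product into O(1/n).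
-- All estimates are made for the rational approximants q of p n.

module Submission where

open import Algebra.Bundles using (CommutativeRing)
import Algebra.Properties.CommutativeMonoid.Sum as Sum
import Algebra.Properties.CommutativeSemigroup as CommutativeSemigroup
import Algebra.Properties.CommutativeSemiring.Exp as Exp
open import Data.Bool.Base using (Bool; true; false; T; not; _∧_; _xor_; if_then_else_)
import Data.Bool.Properties as Bool
open import Data.Fin.Base using (Fin; zero; suc; toℕ; fromℕ<; punchIn; punchOut)
import Data.Fin.Properties as Fin
open import Data.Fin.Subset using (Subset; inside; outside; ∣_∣; _∈_; _∉_; _⊆_; _─_; ⊥)
import Data.Fin.Subset.Properties as Subset
import Data.Integer.Base as ℤ
import Data.Integer.Properties as ℤ
open import Data.List.Base as List using (List; []; _∷_; map; filter; cartesianProductWith)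
import Data.List.Extrema as Extrema
import Data.List.Membership.Propositional as ListMem
import Data.List.Membership.Propositional.Properties as ListMem
import Data.List.Properties as List
import Data.List.Relation.Unary.All as ListAll
import Data.List.Relation.Unary.All.Properties as ListAll
import Data.List.Relation.Unary.Any as ListAny
import Data.List.Relation.Unary.Any.Properties as ListAny
open import Data.Nat.Base as ℕ using (ℕ; zero; suc)
import Data.Nat.DivMod as ℕ
import Data.Nat.Properties as ℕ
open import Data.Product.Base using (∃-syntax; _×_; _,_; proj₁; proj₂)
open import Data.Rational.Base as ℚ using (ℚ; 0ℚ; 1ℚ; ½)
import Data.Rational.Properties as ℚ
open import Data.Rational.Solver using (module +-*-Solver)
import Data.Rational.Unnormalised.Base as ℚᵘ
import Data.Rational.Unnormalised.Properties as ℚᵘ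
open import Data.Sum.Base using (_⊎_; inj₁; inj₂)
open import Data.Vec.Base as Vec
  using (Vec; []; _∷_; lookup; _[_]≔_; replicate; zipWith; _++_; tabulate; here; there)
open import Data.Vec.Functional using (updateAt)
import Data.Vec.Functional.Properties as Vector
import Data.Vec.Properties as Vec
open import Data.Vec.Relation.Unary.All as All using (All; []; _∷_)
import Data.Vec.Relation.Unary.All.Properties as All
open import Function.Base using (_∘_; const)
open import Level using (0ℓ)
import Relation.Binary.Construct.Add.Supremum.NonStrict as AddSup
open import Relation.Binary.PropositionalEquality
import Relation.Binary.Reasoning.Setoid as SetoidReasoning
open import Relation.Nullary.Construct.Add.Supremum using (⊤⁺; [_])
open import Relation.Nullary.Decidable
  using (does; yes; no; dec-true; dec-false; _×-dec_; _→-dec_; decidable-stable)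
open import Relation.Nullary.Negation using (¬_; contradiction)
open import Relation.Unary using (Pred; Decidable)
open import Defs

open Cohomology 𝔽₂ using (altSum; d; IsCocycle; IsCoboundary; H̃≢0)
open CommutativeSemigroup (CommutativeRing.+-commutativeSemigroup 𝔽₂) using (x∙yz≈y∙xz; interchange)
open Sum ℚ.+-0-commutativeMonoid using (sum)
open Exp (CommutativeRing.commutativeSemiring ℚ.+-*-commutativeRing)
  using (_^_; ^-homo-*; ^-assocʳ; ^-distrib-*)

private variable
  A B D : Set
  k m n : ℕ

-- Cross-polytopes in simplicial complexes

infixl 6 _∪｛_｝
_∪｛_｝ : Subset n → Fin n → Subset n
σ ∪｛ v ｝ = σ [ v ]≔ inside

d-inside : (g : Subset (suc n) → Bool) (σ : Subset n) →
  d g (inside ∷ σ) ≡ g (outside ∷ σ) xor d (g ∘ (inside ∷_)) σ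
d-inside g σ = cong (λ l → g (outside ∷ σ) xor altSum l) (sym (List.map-∘ (facets σ)))

d-outside : (g : Subset (suc n) → Bool) (σ : Subset n) →
  d g (outside ∷ σ) ≡ d (g ∘ (outside ∷_)) σ
d-outside g σ = cong altSum (sym (List.map-∘ (facets σ)))

d-⊥ : (g : Subset n → Bool) → d g ⊥ ≡ false
d-⊥ {zero}  g = refl
d-⊥ {suc n} g = trans (d-outside g ⊥) (d-⊥ (g ∘ (outside ∷_)))

-- Removing `v` leaves `σ`; removing any other vertex leaves a facet of `σ` with `v` adjoined. The
-- position of `v` among the vertices does not matter, as there are no signs over `𝔽₂`.
d-∪｛｝ : (g : Subset n → Bool) (σ : Subset n) (v : Fin n) → lookup σ v ≡ outside →
  d g (σ ∪｛ v ｝) ≡ g σ xor d (λ τ → g (τ ∪｛ v ｝)) σ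
d-∪｛｝ g (outside ∷ σ) zero eq = trans (d-inside g σ)
  (cong (g (outside ∷ σ) xor_) (sym (d-outside (λ τ → g (τ ∪｛ zero ｝)) σ)))
d-∪｛｝ g (outside ∷ σ) (suc v) eq = begin
  d g (outside ∷ σ ∪｛ v ｝)                             ≡⟨ d-outside g (σ ∪｛ v ｝) ⟩
  d (g ∘ (outside ∷_)) (σ ∪｛ v ｝)                       ≡⟨ d-∪｛｝ (g ∘ (outside ∷_)) σ v eq ⟩
  g (outside ∷ σ) xor d (λ τ → g (outside ∷ τ ∪｛ v ｝)) σ
    ≡⟨ cong (g (outside ∷ σ) xor_) (d-outside (λ τ → g (τ ∪｛ suc v ｝)) σ) ⟨
  g (outside ∷ σ) xor d (λ τ → g (τ ∪｛ suc v ｝)) (outside ∷ σ) ∎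
  where open ≡-Reasoning
d-∪｛｝ g (inside ∷ σ) (suc v) eq = begin
  d g (inside ∷ σ ∪｛ v ｝)                               ≡⟨ d-inside g (σ ∪｛ v ｝) ⟩
  a xor d (g ∘ (inside ∷_)) (σ ∪｛ v ｝)                  ≡⟨ cong (a xor_) (d-∪｛｝ (g ∘ (inside ∷_)) σ v eq) ⟩
  a xor (g (inside ∷ σ) xor c)                            ≡⟨ x∙yz≈y∙xz a (g (inside ∷ σ)) c ⟩
  g (inside ∷ σ) xor (a xor c)                            ≡⟨ cong (g (inside ∷ σ) xor_) (d-inside (λ τ → g (τ ∪｛ suc v ｝)) σ) ⟨
  g (inside ∷ σ) xor d (λ τ → g (τ ∪｛ suc v ｝)) (inside ∷ σ) ∎
  where
  open ≡-Reasoning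
  a = g (outside ∷ σ ∪｛ v ｝)
  c = d (λ τ → g (inside ∷ τ ∪｛ v ｝)) σ

-- A hypothesis on all subsets passes through the induction without a description of the members of
-- `facets σ`.
d-vanishes : (g : Subset n → Bool) (σ : Subset n) → (∀ τ → τ ⊆ σ → g τ ≡ false) → d g σ ≡ false
d-vanishes g []            g≡false = refl
d-vanishes g (inside ∷ σ)  g≡false = trans (d-inside g σ) (cong₂ _xor_
  (g≡false (outside ∷ σ) (Subset.out⊆ Subset.⊆-refl))
  (d-vanishes (g ∘ (inside ∷_)) σ (λ τ τ⊆σ → g≡false (inside ∷ τ) (Subset.in⊆in τ⊆σ))))
d-vanishes g (outside ∷ σ) g≡false = trans (d-outside g σ)
  (d-vanishes (g ∘ (outside ∷_)) σ (λ τ τ⊆σ → g≡false (outside ∷ τ) (Subset.out⊆ τ⊆σ)))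

-- Sums over sign vectors

⨁ : ∀ k → (Vec Bool k → Bool) → Bool
⨁ zero    f = f []
⨁ (suc k) f = ⨁ k (λ ε → f (true ∷ ε)) xor ⨁ k (λ ε → f (false ∷ ε))

⨁-cong : ∀ k {f g : Vec Bool k → Bool} → (∀ ε → f ε ≡ g ε) → ⨁ k f ≡ ⨁ k g
⨁-cong zero    f≗g = f≗g []
⨁-cong (suc k) f≗g = cong₂ _xor_ (⨁-cong k (f≗g ∘ (true ∷_))) (⨁-cong k (f≗g ∘ (false ∷_)))

⨁-xor : ∀ k (f g : Vec Bool k → Bool) → ⨁ k (λ ε → f ε xor g ε) ≡ ⨁ k f xor ⨁ k g
⨁-xor zero    f g = refl
⨁-xor (suc k) f g = begin
  ⨁ k (λ ε → f (true ∷ ε) xor g (true ∷ ε)) xor ⨁ k (λ ε → f (false ∷ ε) xor g (false ∷ ε))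
    ≡⟨ cong₂ _xor_ (⨁-xor k _ _) (⨁-xor k _ _) ⟩
  (⨁ k (f ∘ (true ∷_)) xor ⨁ k (g ∘ (true ∷_))) xor (⨁ k (f ∘ (false ∷_)) xor ⨁ k (g ∘ (false ∷_)))
    ≡⟨ interchange (⨁ k (f ∘ (true ∷_))) _ _ _ ⟩
  ⨁ (suc k) f xor ⨁ (suc k) g ∎
  where open ≡-Reasoning

⨁-false : ∀ k {f : Vec Bool k → Bool} → (∀ ε → f ε ≡ false) → ⨁ k f ≡ false
⨁-false zero    f≡false = f≡false []
⨁-false (suc k) f≡false = cong₂ _xor_ (⨁-false k (f≡false ∘ (true ∷_))) (⨁-false k (f≡false ∘ (false ∷_)))

-- Every sign vector other than the all-`true` one has a `false` coordinate, so at most one summand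
-- survives.
⨁-single : ∀ k (f : Vec Bool k → Bool) → (∀ ε j → lookup ε j ≡ false → f ε ≡ false) →
  ⨁ k f ≡ f (replicate k true)
⨁-single zero    f f≡false = refl
⨁-single (suc k) f f≡false = trans
  (cong₂ _xor_ (⨁-single k (f ∘ (true ∷_)) (λ ε j → f≡false (true ∷ ε) (suc j)))
               (⨁-false k (λ ε → f≡false (false ∷ ε) zero refl)))
  (Bool.xor-identityʳ _)

-- The facets of the cross-polytope with antipodal pairs x j true, x j false.
face : (Fin k → Bool → Fin n) → Vec Bool k → Subset n
face x []      = ⊥
face x (b ∷ ε) = face (x ∘ suc) ε ∪｛ x zero b ｝

PairsDisjoint : (Fin k → Bool → Fin n) → Set
PairsDisjoint x = ∀ {j l} b c → j ≢ l → x j b ≢ x l c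

∪｛｝-∈⁻ : (σ : Subset n) (v : Fin n) {u : Fin n} → u ∈ σ ∪｛ v ｝ → u ≡ v ⊎ u ∈ σ
∪｛｝-∈⁻ σ v {u} u∈ with u Fin.≟ v
... | yes u≡v = inj₁ u≡v
... | no  u≢v = inj₂ (Vec.lookup⇒[]= u σ
  (trans (sym (Vec.lookup∘updateAt′ u v u≢v σ)) (Vec.[]=⇒lookup u∈)))

∪｛｝-∈⁺ : (σ : Subset n) (v : Fin n) {u : Fin n} → u ∈ σ → u ∈ σ ∪｛ v ｝
∪｛｝-∈⁺ (_ ∷ σ) zero    here      = here
∪｛｝-∈⁺ (_ ∷ σ) zero    (there p) = there p
∪｛｝-∈⁺ (_ ∷ σ) (suc v) here      = here
∪｛｝-∈⁺ (_ ∷ σ) (suc v) (there p) = there (∪｛｝-∈⁺ σ v p)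

∣∪｛｝∣ : (σ : Subset n) (v : Fin n) → lookup σ v ≡ outside → ∣ σ ∪｛ v ｝ ∣ ≡ suc ∣ σ ∣
∣∪｛｝∣ (outside ∷ σ) zero    eq = refl
∣∪｛｝∣ (outside ∷ σ) (suc v) eq = ∣∪｛｝∣ σ v eq
∣∪｛｝∣ (inside ∷ σ)  (suc v) eq = cong suc (∣∪｛｝∣ σ v eq)

face-∈⁻ : (x : Fin k → Bool → Fin n) (ε : Vec Bool k) {u : Fin n} →
  u ∈ face x ε → ∃[ j ] u ≡ x j (lookup ε j)
face-∈⁻ x []      u∈ = contradiction u∈ Subset.∉⊥
face-∈⁻ x (b ∷ ε) u∈ with ∪｛｝-∈⁻ (face (x ∘ suc) ε) (x zero b) u∈
... | inj₁ u≡x = zero , u≡x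
... | inj₂ u∈′ with face-∈⁻ (x ∘ suc) ε u∈′
...   | j , u≡x = suc j , u≡x

face-∈⁺ : (x : Fin k → Bool → Fin n) (ε : Vec Bool k) (j : Fin k) → x j (lookup ε j) ∈ face x ε
face-∈⁺ x (b ∷ ε) zero    = Vec.lookup⇒[]= (x zero b) _ (Vec.lookup∘updateAt (x zero b) (face (x ∘ suc) ε))
face-∈⁺ x (b ∷ ε) (suc j) = ∪｛｝-∈⁺ (face (x ∘ suc) ε) (x zero b) (face-∈⁺ (x ∘ suc) ε j)

tail-disjoint : {x : Fin (suc k) → Bool → Fin n} → PairsDisjoint x → PairsDisjoint (x ∘ suc)
tail-disjoint disjoint b c j≢l = disjoint b c (j≢l ∘ Fin.suc-injective)

face-tail : {x : Fin (suc k) → Bool → Fin n} → PairsDisjoint x →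
  ∀ b ε → lookup (face (x ∘ suc) ε) (x zero b) ≡ outside
face-tail {x = x} disjoint b ε with lookup (face (x ∘ suc) ε) (x zero b) in eq
... | false = refl
... | true with face-∈⁻ (x ∘ suc) ε (Vec.lookup⇒[]= (x zero b) _ eq)
...   | j , x₀≡x = contradiction x₀≡x (disjoint b (lookup ε j) λ ())

∣face∣ : (x : Fin k → Bool → Fin n) → PairsDisjoint x → ∀ ε → ∣ face x ε ∣ ≡ k
∣face∣ {n = n} x disjoint []      = Subset.∣⊥∣≡0 n
∣face∣ x disjoint (b ∷ ε) = trans
  (∣∪｛｝∣ (face (x ∘ suc) ε) (x zero b) (face-tail disjoint b ε))
  (cong suc (∣face∣ (x ∘ suc) (tail-disjoint disjoint) ε))

-- The cross-polytope is a cycle, by suspension: the facet of `face x (b ∷ ε)` opposite to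
-- `x zero b` is the same for both `b` and cancels, and the facets through `x zero b` cancel by
-- induction in the link of that vertex.
⨁-d-face : (x : Fin k → Bool → Fin n) → PairsDisjoint x → (g : Subset n → Bool) →
  ⨁ k (d g ∘ face x) ≡ false
⨁-d-face {zero}  x disjoint g = d-⊥ g
⨁-d-face {suc k} x disjoint g =
  trans (cong₂ _xor_ (half true) (half false)) (Bool.xor-same (⨁ k (g ∘ face (x ∘ suc))))
  where
  half : ∀ b → ⨁ k (λ ε → d g (face x (b ∷ ε))) ≡ ⨁ k (g ∘ face (x ∘ suc))
  half b = begin
    ⨁ k (λ ε → d g (face x (b ∷ ε)))
      ≡⟨ ⨁-cong k (λ ε → d-∪｛｝ g (face (x ∘ suc) ε) (x zero b) (face-tail disjoint b ε)) ⟩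
    ⨁ k (λ ε → g (face (x ∘ suc) ε) xor d g′ (face (x ∘ suc) ε))
      ≡⟨ ⨁-xor k _ _ ⟩
    ⨁ k (g ∘ face (x ∘ suc)) xor ⨁ k (d g′ ∘ face (x ∘ suc))
      ≡⟨ cong (⨁ k (g ∘ face (x ∘ suc)) xor_) (⨁-d-face (x ∘ suc) (tail-disjoint disjoint) g′) ⟩
    ⨁ k (g ∘ face (x ∘ suc)) xor false
      ≡⟨ Bool.xor-identityʳ _ ⟩
    ⨁ k (g ∘ face (x ∘ suc)) ∎
    where
    open ≡-Reasoning
    g′ = λ τ → g (τ ∪｛ x zero b ｝)

-- A facet of a cross-polytope sphere that is a maximal simplex of X carries a
-- cocycle which pairs to 1 with the fundamental cycle of the sphere.
crossPolytope⇒H̃≢0 : ∀ {N} (X : SimplicialComplex N) i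
  (x : Fin (suc i) → Bool → Fin N) → PairsDisjoint x →
  (∀ j → x j false ≢ x j true) →
  (∀ ε → SimplicialComplex.Simplex X (face x ε)) →
  (∀ σ → SimplicialComplex.OfCard X (2 ℕ.+ i) σ → ¬ face x (replicate (suc i) true) ⊆ σ) →
  H̃≢0 X i
crossPolytope⇒H̃≢0 {N} X i x disjoint antipodes simplices maximal = f , cocycle , ¬coboundary
  where
  open ≡-Reasoning
  σ₀ = face x (replicate (suc i) true)
  f : Subset N → Bool
  f σ = does (σ₀ Subset.⊆? σ)

  cocycle : IsCocycle X i f
  -- No simplex with one more vertex contains `σ₀`, hence none of its facets does.
  cocycle σ σ∈X = d-vanishes f σ (λ τ τ⊆σ →
    dec-false (σ₀ Subset.⊆? τ) (λ σ₀⊆τ → maximal σ σ∈X (λ u∈ → τ⊆σ (σ₀⊆τ u∈))))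

  f-face : ∀ ε j → lookup ε j ≡ false → f (face x ε) ≡ false
  f-face ε j εj≡false = dec-false (σ₀ Subset.⊆? face x ε) λ σ₀⊆ →
    let l , eq = face-∈⁻ x ε (σ₀⊆ (subst (λ b → x j b ∈ σ₀)
          (Vec.lookup-replicate j true) (face-∈⁺ x (replicate (suc i) true) j)))
    in absurd l eq
    where
    absurd : ∀ l → x j true ≡ x l (lookup ε l) → _
    absurd l eq with j Fin.≟ l
    ... | yes refl = antipodes j (sym (trans eq (cong (x j) εj≡false)))
    ... | no j≢l   = disjoint true (lookup ε l) j≢l eq

  ¬coboundary : ¬ IsCoboundary X i f
  ¬coboundary (g , f≡dg) with () ← (begin
    true                              ≡⟨ dec-true (σ₀ Subset.⊆? σ₀) Subset.⊆-refl ⟨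
    f σ₀                              ≡⟨ ⨁-single (suc i) (f ∘ face x) f-face ⟨
    ⨁ (suc i) (f ∘ face x)            ≡⟨ ⨁-cong (suc i) (λ ε → f≡dg (face x ε) (simplices ε , ∣face∣ x disjoint ε)) ⟩
    ⨁ (suc i) (d g ∘ face x)          ≡⟨ ⨁-d-face x disjoint g ⟩
    false                             ∎)

-- Cross-polytopes in graphs

∈⟦⟧⁺ : ∀ {P : Pred (Fin n) _} (P? : Decidable {ℓ = 0ℓ} P) {u} → P u → u ∈ ⟦ P? ⟧
∈⟦⟧⁺ P? {u} pu = Vec.lookup⇒[]= u _ (trans (Vec.lookup∘tabulate (does ∘ P?) u) (dec-true (P? u) pu))

∈⟦⟧⁻ : ∀ {P : Pred (Fin n) _} (P? : Decidable {ℓ = 0ℓ} P) {u} → u ∈ ⟦ P? ⟧ → P u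
∈⟦⟧⁻ P? {u} u∈ with P? u in eq
... | yes pu = pu
... | no ¬pu with () ← trans (sym (cong does eq))
  (trans (sym (Vec.lookup∘tabulate (does ∘ P?) u)) (Vec.[]=⇒lookup u∈))

module _ (G : Graph n) where
  open Graph G

  ∈CommonNbhd⁺ : ∀ I {u} → (∀ c → c ∈ I → Adj c u) → u ∈ CommonNbhd G I
  ∈CommonNbhd⁺ I adj = ∈⟦⟧⁺ (λ u → Fin.all? λ c → c Subset.∈? I →-dec u Subset.∈? Nbhd G c)
    (λ c c∈I → ∈⟦⟧⁺ (adj? c) (adj c c∈I))

  ∈CommonNbhd⁻ : ∀ I {u} → u ∈ CommonNbhd G I → ∀ c → c ∈ I → Adj c u
  ∈CommonNbhd⁻ I u∈ c c∈I = ∈⟦⟧⁻ (adj? c)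
    (∈⟦⟧⁻ (λ u → Fin.all? λ c → c Subset.∈? I →-dec u Subset.∈? Nbhd G c) u∈ c c∈I)

  Adj⇒≢ : ∀ {u v} → Adj u v → u ≢ v
  Adj⇒≢ uv refl = adj-irrefl uv

-- No vertex is adjacent to itself, so `¬adjacent` alone would admit `b` as the new vertex.
record Extension (G : Graph n) (b : Fin n) {m} (as : Vec (Fin n) m) : Set where
  open Graph G
  field
    vertex    : Fin n
    vertex∈V  : vertex ∈ V
    vertex≢b  : vertex ≢ b
    ¬adjacent : ¬ Adj vertex b
    adjacents : All (Adj vertex) as

-- Entries of `as` may repeat. This matters below, where the list holds both the `v l` and the
-- current `w l`, which coincide until `w l` is replaced.
Extendable : ℕ → Graph n → Set
Extendable {n} m G = ∀ b (as : Vec (Fin n) m) → All (_≢ b) as → Extension G b as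

record Enumeration (I : Subset n) (k : ℕ) : Set where
  field
    element   : Fin k → Fin n
    injective : ∀ {j l} → element j ≡ element l → j ≡ l
    member    : ∀ j → element j ∈ I
    complete  : ∀ {u} → u ∈ I → ∃[ j ] u ≡ element j

enumerate : (I : Subset n) → Enumeration I ∣ I ∣
enumerate [] = record
  { element = λ () ; injective = λ { {()} } ; member = λ () ; complete = λ () }
enumerate (inside ∷ I) = record
  { element   = λ { zero → zero ; (suc j) → suc (element j) }
  ; injective = λ { {zero} {zero} _ → refl
                  ; {suc j} {suc l} eq → cong suc (injective (Fin.suc-injective eq)) }
  ; member    = λ { zero → here ; (suc j) → there (member j) }
  ; complete  = λ { here → zero , refl
                  ; (there u∈I) → let j , eq = complete u∈I in suc j , cong suc eq }
  } where open Enumeration (enumerate I)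
enumerate (outside ∷ I) = record
  { element   = suc ∘ element
  ; injective = injective ∘ Fin.suc-injective
  ; member    = there ∘ member
  ; complete  = λ { (there u∈I) → let j , eq = complete u∈I in j , cong suc eq }
  } where open Enumeration (enumerate I)

-- Construction of the antipodes

module _ (G : Graph n) {i : ℕ} (extend : Extendable (i ℕ.+ i) G)
  (v : Fin (suc i) → Fin n)
  (v∈V : ∀ j → v j ∈ Graph.V G)
  (v-clique : ∀ {j l} → j ≢ l → Graph.Adj G (v j) (v l))
  where
  open Graph G

  -- The vertices w j with j < t have been replaced by antipodes of v j.
  record Antipodes (t : ℕ) : Set where
    field
      w        : Fin (suc i) → Fin n
      w∈V      : ∀ j → w j ∈ V
      w-v      : ∀ {j l} → j ≢ l → Adj (w j) (v l)
      w-w      : ∀ {j l} → j ≢ l → Adj (w j) (w l)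
      antipode : ∀ j → toℕ j ℕ.< t → w j ≢ v j × ¬ Adj (w j) (v j)

  replaceNext : ∀ {t} → t ℕ.< suc i → Antipodes t → Antipodes (suc t)
  replaceNext {t} t<1+i antipodes = record
    { w = w′ ; w∈V = w′∈V ; w-v = w′-v ; w-w = w′-w ; antipode = antipode′ }
    where
    open Antipodes antipodes
    j = fromℕ< t<1+i
    apart-v : ∀ l → v (punchIn j l) ≢ v j
    apart-v l eq = Adj⇒≢ G (v-clique (Fin.punchInᵢ≢i j l)) eq
    apart-w : ∀ l → w (punchIn j l) ≢ v j
    apart-w l eq = Adj⇒≢ G (w-v (Fin.punchInᵢ≢i j l)) eq
    -- `punchIn j` runs through the `i` indices other than `j`, so the two lists together have
    -- `i + i` entries.
    open Extension (extend (v j) (tabulate (v ∘ punchIn j) ++ tabulate (w ∘ punchIn j))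
      (All.++⁺ (All.tabulate⁺ apart-v) (All.tabulate⁺ apart-w)))
    u = vertex
    others : ∀ (z : Fin (suc i) → Fin n) → All (Adj u) (tabulate (z ∘ punchIn j)) →
      ∀ {l} → j ≢ l → Adj u (z l)
    others z adj j≢l = subst (λ l → Adj u (z l)) (Fin.punchIn-punchOut j≢l)
      (All.tabulate⁻ adj (punchOut j≢l))
    u-v : ∀ {l} → j ≢ l → Adj u (v l)
    u-v = others v (All.++ˡ⁻ (tabulate (v ∘ punchIn j)) adjacents)
    u-w : ∀ {l} → j ≢ l → Adj u (w l)
    u-w = others w (All.++ʳ⁻ (tabulate (v ∘ punchIn j)) adjacents)
    w′ = updateAt w j (const u)
    new : w′ j ≡ u
    new = Vector.updateAt-updates j w
    old : ∀ {l} → l ≢ j → w′ l ≡ w l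
    old {l} l≢j = Vector.updateAt-minimal l j w l≢j
    by-cases : (P : Fin (suc i) → Fin n → Set) → P j u → (∀ l → l ≢ j → P l (w l)) → ∀ l → P l (w′ l)
    by-cases P Pu Pw l with l Fin.≟ j
    ... | yes refl = subst (P j) (sym new) Pu
    ... | no l≢j   = subst (P l) (sym (old l≢j)) (Pw l l≢j)
    w′∈V : ∀ l → w′ l ∈ V
    w′∈V = by-cases (λ _ z → z ∈ V) vertex∈V (λ l _ → w∈V l)
    w′-v : ∀ {l r} → l ≢ r → Adj (w′ l) (v r)
    w′-v {l} = by-cases (λ l z → ∀ {r} → l ≢ r → Adj z (v r)) u-v (λ l _ → w-v) l
    w′-w : ∀ {l r} → l ≢ r → Adj (w′ l) (w′ r)
    w′-w {l} {r} = by-cases (λ l z → ∀ r → l ≢ r → Adj z (w′ r))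
      (by-cases (λ r z → j ≢ r → Adj u z) (λ j≢j → contradiction refl j≢j) (λ r _ → u-w))
      (λ l l≢j → by-cases (λ r z → l ≢ r → Adj (w l) z) (λ _ → adj-sym (u-w (≢-sym l≢j))) (λ r _ → w-w))
      l r
    antipode′ : ∀ l → toℕ l ℕ.< suc t → w′ l ≢ v l × ¬ Adj (w′ l) (v l)
    antipode′ = by-cases (λ l z → toℕ l ℕ.< suc t → z ≢ v l × ¬ Adj z (v l))
      (λ _ → vertex≢b , ¬adjacent)
      (λ l l≢j l<1+t → antipode l (ℕ.≤∧≢⇒< (ℕ.s≤s⁻¹ l<1+t)
        (λ l≡t → l≢j (Fin.toℕ-injective (trans l≡t (sym (Fin.toℕ-fromℕ< t<1+i)))))))

  replaceAll : ∀ t → t ℕ.≤ suc i → Antipodes t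
  -- At the start `w` is `v` itself, and no index is yet subject to `antipode`.
  replaceAll zero    _     = record { w = v ; w∈V = v∈V ; w-v = v-clique ; w-w = v-clique ; antipode = λ _ () }
  replaceAll (suc t) t<1+i = replaceNext t<1+i (replaceAll t (ℕ.<⇒≤ t<1+i))

-- Removal of the common neighbours of a simplex

module _ (G : Graph n) {i : ℕ} (extend : Extendable (i ℕ.+ i) G)
  {I : Subset n} (I-simplex : SimplicialComplex.OfCard (Cl G) (suc i) I)
  where
  open Graph G

  private
    C = CommonNbhd G I
    I⊆V = proj₁ (proj₁ I-simplex)
    I-clique = proj₂ (proj₁ I-simplex)
    open Enumeration (subst (Enumeration I) (proj₂ I-simplex) (enumerate I))
      renaming (element to v)
    v-clique : ∀ {j l} → j ≢ l → Adj (v j) (v l)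
    v-clique {j} {l} j≢l = I-clique (v j) (v l) (member j) (member l) (j≢l ∘ injective)
    open Antipodes (replaceAll G extend v (I⊆V ∘ member) v-clique (suc i) ℕ.≤-refl)

    x : Fin (suc i) → Bool → Fin n
    x j b = if b then v j else w j

    x-adj : ∀ {j l} b c → j ≢ l → Adj (x j b) (x l c)
    x-adj true  true  j≢l = v-clique j≢l
    x-adj true  false j≢l = adj-sym (w-v (≢-sym j≢l))
    x-adj false true  j≢l = w-v j≢l
    x-adj false false j≢l = w-w j≢l

    -- A vertex in `C` is adjacent to every `v j`, whereas neither `v j` nor its antipode `w j` is
    -- adjacent to `v j`.
    x∉C : ∀ j b → x j b ∉ C
    x∉C j true  v∈C = adj-irrefl (∈CommonNbhd⁻ G I v∈C (v j) (member j))
    x∉C j false w∈C = proj₂ (antipode j (Fin.toℕ<n j)) (adj-sym (∈CommonNbhd⁻ G I w∈C (v j) (member j)))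

    x∈V : ∀ j b → x j b ∈ V
    x∈V j true  = I⊆V (member j)
    x∈V j false = w∈V j

    simplices : ∀ ε → SimplicialComplex.Simplex (Cl (G − C)) (face x ε)
    simplices ε =
      (λ u∈ → let j , u≡x = face-∈⁻ x ε u∈ in
        subst (_∈ V ─ C) (sym u≡x) (Subset.x∈p∧x∉q⇒x∈p─q (x∈V j (lookup ε j)) (x∉C j (lookup ε j)))) ,
      (λ u u′ u∈ u′∈ u≢u′ →
        let j , u≡x = face-∈⁻ x ε u∈
            l , u′≡x = face-∈⁻ x ε u′∈
        in subst₂ (λ y y′ → Adj y y′ × y ∉ C × y′ ∉ C) (sym u≡x) (sym u′≡x)
             (x-adj (lookup ε j) (lookup ε l)
                (λ j≡l → u≢u′ (trans u≡x (trans (cong (λ j → x j (lookup ε j)) j≡l) (sym u′≡x))))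
             , x∉C j (lookup ε j) , x∉C l (lookup ε l)))

    σ₀ = face x (replicate (suc i) true)

    v∈σ₀ : ∀ j → v j ∈ σ₀
    v∈σ₀ j = subst (λ b → x j b ∈ σ₀) (Vec.lookup-replicate j true) (face-∈⁺ x (replicate (suc i) true) j)

    disjoint : PairsDisjoint x
    disjoint b c j≢l = Adj⇒≢ G (x-adj b c j≢l)

    -- A further vertex of σ would be a common neighbour of I.
    maximal : ∀ σ → SimplicialComplex.OfCard (Cl (G − C)) (2 ℕ.+ i) σ → ¬ σ₀ ⊆ σ
    maximal σ ((σ⊆V─C , σ-clique) , ∣σ∣≡2+i) σ₀⊆σ =
      ℕ.<-irrefl refl (subst₂ ℕ._≤_ ∣σ∣≡2+i (∣face∣ x disjoint (replicate (suc i) true))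
        (Subset.p⊆q⇒∣p∣≤∣q∣ σ⊆σ₀))
      where
      σ⊆σ₀ : σ ⊆ σ₀
      σ⊆σ₀ {u} u∈σ = decidable-stable (u Subset.∈? σ₀) λ u∉σ₀ →
        let u-adj : ∀ c → c ∈ I → Adj c u × c ∉ C × u ∉ C
            u-adj c c∈I =
              let j , c≡v = complete c∈I
                  c∈σ₀ = subst (_∈ σ₀) (sym c≡v) (v∈σ₀ j)
              in σ-clique c u (σ₀⊆σ c∈σ₀) u∈σ (λ { refl → u∉σ₀ c∈σ₀ })
        in proj₂ (proj₂ (u-adj (v zero) (member zero)))
             (∈CommonNbhd⁺ G I (λ c c∈I → proj₁ (u-adj c c∈I)))

  -- `I` has `suc i` elements, so it contains a vertex `v zero`, whose neighbours lie in `V`.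
  CommonNbhd⊆V : CommonNbhd G I ⊆ V
  CommonNbhd⊆V u∈C = adj-in-V (adj-sym (∈CommonNbhd⁻ G I u∈C (v zero) (member zero)))

  H̃[G−CommonNbhd]≢0 : H̃≢0 (Cl (G − CommonNbhd G I)) i
  H̃[G−CommonNbhd]≢0 = crossPolytope⇒H̃≢0 (Cl (G − C)) i x disjoint
    (λ j → proj₁ (antipode j (Fin.toℕ<n j))) simplices maximal

-- Comparison of the two minima

∈-subsets : (S : Subset n) → S ListMem.∈ subsets n
∈-subsets []            = ListAny.here refl
∈-subsets (inside ∷ S)  = ListMem.∈-++⁺ˡ (ListMem.∈-map⁺ (inside ∷_) (∈-subsets S))
∈-subsets (outside ∷ S) = ListMem.∈-++⁺ʳ (List.map (inside ∷_) (subsets _)) (ListMem.∈-map⁺ (outside ∷_) (∈-subsets S))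

-- For each simplex `I` that competes in `δ`, the set of its common neighbours competes in `κ-𝔽₂`.
extendable⇒κ≤δ : (G : Graph n) (i : ℕ) → Extendable (i ℕ.+ i) G → κ-𝔽₂ i G ≤∞ δ i G
-- The default value `⊤⁺` of the minimum accounts for graphs without `i`-simplices.
extendable⇒κ≤δ {n} G i extend = v≤min⁺ (AddSup._≤⊤⁺ _)
  (ListAll.map⁺ (ListAll.map⁺ (ListAll.map κ≤∣N∣
    (ListAll.all-filter (SimplicialComplex.ofCard? (Cl G) (suc i)) (subsets n)))))
  where
  open Extrema ≤∞-totalOrder
  κ≤∣N∣ : ∀ {I} → SimplicialComplex.OfCard (Cl G) (suc i) I →
    κ-𝔽₂ i G ≤∞ [ ∣ CommonNbhd G I ∣ ]
  κ≤∣N∣ {I} I-simplex = min≤v⁺ ⊤⁺ _ (inj₂ (ListAny.map⁺ (ListAny.map⁺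
    (ListMem.lose
      (ListMem.∈-filter⁺ (λ C → C Subset.⊆? Graph.V G ×-dec H̃≢0-𝔽₂? (Cl (G − C)) i)
        (∈-subsets (CommonNbhd G I))
        (CommonNbhd⊆V G extend I-simplex , H̃[G−CommonNbhd]≢0 G extend I-simplex))
      AddSup.[ ℕ.≤-refl ]))))

-- Inequalities between rational numbers

module _ where
  open import Data.Rational.Base using (_+_; _*_; _-_; _≤_; _<_)
  open +-*-Solver

  ≤-by-difference : ∀ {p q} r → 0ℚ ≤ r → p + r ≡ q → p ≤ q
  ≤-by-difference {p} r 0≤r refl = subst (_≤ p + r) (ℚ.+-identityʳ p) (ℚ.+-monoʳ-≤ p 0≤r)

  ≤-respˡ-≡ : ∀ {p q r} → p ≡ q → p ≤ r → q ≤ r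
  ≤-respˡ-≡ refl p≤r = p≤r

  ≤-respʳ-≡ : ∀ {p q r} → p ≡ q → r ≤ p → r ≤ q
  ≤-respʳ-≡ refl r≤p = r≤p

  0≤q-p : ∀ {p q} → p ≤ q → 0ℚ ≤ q - p
  0≤q-p {p} {q} p≤q = subst (_≤ q - p) (ℚ.+-inverseʳ p) (ℚ.+-monoˡ-≤ (ℚ.- p) p≤q)

  *-mono-≤ : ∀ {p q r s} → 0ℚ ≤ p → 0ℚ ≤ s → p ≤ q → r ≤ s → p * r ≤ q * s
  *-mono-≤ {p} {s = s} 0≤p 0≤s p≤q r≤s = ℚ.≤-trans
    (ℚ.*-monoˡ-≤-nonNeg p {{ℚ.nonNegative 0≤p}} r≤s)
    (ℚ.*-monoʳ-≤-nonNeg s {{ℚ.nonNegative 0≤s}} p≤q)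

  0≤p*q : ∀ {p q} → 0ℚ ≤ p → 0ℚ ≤ q → 0ℚ ≤ p * q
  0≤p*q {p} {q} 0≤p 0≤q = subst (_≤ p * q) (ℚ.*-zeroˡ q)
    (ℚ.*-monoʳ-≤-nonNeg q {{ℚ.nonNegative 0≤q}} 0≤p)

  0≤1 : 0ℚ ≤ 1ℚ
  0≤1 = ℚ.<⇒≤ (ℚ.positive⁻¹ 1ℚ)

  0≤p^n : ∀ {p} → 0ℚ ≤ p → ∀ n → 0ℚ ≤ p ^ n
  0≤p^n 0≤p zero    = 0≤1
  0≤p^n 0≤p (suc n) = 0≤p*q 0≤p (0≤p^n 0≤p n)

  ^-monoˡ-≤ : ∀ {p q} → 0ℚ ≤ p → p ≤ q → ∀ n → p ^ n ≤ q ^ n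
  ^-monoˡ-≤ 0≤p p≤q zero    = ℚ.≤-refl
  ^-monoˡ-≤ 0≤p p≤q (suc n) =
    *-mono-≤ 0≤p (0≤p^n (ℚ.≤-trans 0≤p p≤q) n) p≤q (^-monoˡ-≤ 0≤p p≤q n)

  ^-≤1 : ∀ {p} → 0ℚ ≤ p → p ≤ 1ℚ → ∀ n → p ^ n ≤ 1ℚ
  ^-≤1 0≤p p≤1 zero    = ℚ.≤-refl
  ^-≤1 0≤p p≤1 (suc n) = *-mono-≤ 0≤p 0≤1 p≤1 (^-≤1 0≤p p≤1 n)

  ^-antimonoʳ-≤ : ∀ {p m n} → 0ℚ ≤ p → p ≤ 1ℚ → m ℕ.≤ n → p ^ n ≤ p ^ m
  ^-antimonoʳ-≤ 0≤p p≤1 (ℕ.z≤n {n}) = ^-≤1 0≤p p≤1 n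
  ^-antimonoʳ-≤ {m = suc m} 0≤p p≤1 (ℕ.s≤s m≤n) =
    *-mono-≤ 0≤p (0≤p^n 0≤p m) ℚ.≤-refl (^-antimonoʳ-≤ 0≤p p≤1 m≤n)

  -- Finite expectations

  -- Coins, random subsets and random graphs all satisfy these laws, so the rules below are proved
  -- once for all of them.
  record IsExpectation {A : Set} (E : (A → ℚ) → ℚ) : Set where
    field
      mono        : ∀ {f g} → (∀ x → f x ≤ g x) → E f ≤ E g
      additive    : ∀ f g → E (λ x → f x + g x) ≡ E f + E g
      homogeneous : ∀ c f → E (λ x → c * f x) ≡ c * E f
      total       : E (const 1ℚ) ≡ 1ℚ

    cong-≗ : ∀ {f g} → f ≗ g → E f ≡ E g
    cong-≗ f≗g = ℚ.≤-antisym (mono (λ x → ℚ.≤-reflexive (f≗g x)))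
                             (mono (λ x → ℚ.≤-reflexive (sym (f≗g x))))

    constant : ∀ c → E (const c) ≡ c
    constant c = begin
      E (const c)           ≡⟨ cong-≗ (λ _ → sym (ℚ.*-identityʳ c)) ⟩
      E (λ _ → c * 1ℚ)      ≡⟨ homogeneous c (const 1ℚ) ⟩
      c * E (const 1ℚ)      ≡⟨ cong (c *_) total ⟩
      c * 1ℚ                ≡⟨ ℚ.*-identityʳ c ⟩
      c                     ∎
      where open ≡-Reasoning

    homogeneousʳ : ∀ f c → E (λ x → f x * c) ≡ E f * c
    homogeneousʳ f c = trans (cong-≗ (λ x → ℚ.*-comm (f x) c))
      (trans (homogeneous c f) (ℚ.*-comm c (E f)))

    complement : ∀ f → E (λ x → 1ℚ - f x) ≡ 1ℚ - E f
    complement f = begin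
      E (λ x → 1ℚ - f x)                       ≡⟨ add-sub (E (λ x → 1ℚ - f x)) (E f) ⟩
      (E (λ x → 1ℚ - f x) + E f) - E f         ≡⟨ cong (_- E f) (sym (additive _ f)) ⟩
      E (λ x → (1ℚ - f x) + f x) - E f         ≡⟨ cong (_- E f) (cong-≗ (λ x → sub-add (f x))) ⟩
      E (const 1ℚ) - E f                       ≡⟨ cong (_- E f) total ⟩
      1ℚ - E f                                 ∎
      where
      open ≡-Reasoning
      add-sub : ∀ a b → a ≡ (a + b) - b
      add-sub = solve 2 (λ a b → a := (a :+ b) :- b) refl
      sub-add : ∀ a → (1ℚ - a) + a ≡ 1ℚ
      sub-add = solve 1 (λ a → (con 1ℚ :- a) :+ a := con 1ℚ) refl

  open IsExpectation

  dirac : (x : A) → IsExpectation (λ f → f x)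
  dirac x = record
    { mono = λ f≤g → f≤g x
    ; additive = λ _ _ → refl ; homogeneous = λ _ _ → refl ; total = refl }

  -- Independence is built in: the law `F` of `y` does not depend on `x`.
  iterated : {E : (A → ℚ) → ℚ} {F : (B → ℚ) → ℚ} → IsExpectation E → IsExpectation F →
    (h : A → B → D) → IsExpectation (λ f → E (λ x → F (λ y → f (h x y))))
  iterated e f h = record
    { mono = λ f≤g → mono e (λ x → mono f (λ y → f≤g (h x y)))
    ; additive = λ u v → trans (cong-≗ e (λ x → additive f _ _)) (additive e _ _)
    ; homogeneous = λ c u → trans (cong-≗ e (λ x → homogeneous f c _)) (homogeneous e c _)
    ; total = trans (cong-≗ e (λ x → total f)) (total e) }

  𝔼-coin : ℚ → (Bool → ℚ) → ℚ
  𝔼-coin q f = q * f true + (1ℚ - q) * f false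

  𝔼-subset : ∀ n → ℚ → (Subset n → ℚ) → ℚ
  𝔼-subset zero    q f = f []
  𝔼-subset (suc n) q f = 𝔼-coin q (λ b → 𝔼-subset n q (λ S → f (b ∷ S)))

  𝔼 : ∀ n → ℚ → (Ω n → ℚ) → ℚ
  𝔼 zero    q f = f ∅
  𝔼 (suc n) q f = 𝔼-subset n q (λ S → 𝔼 n q (λ Γ → f (Γ ▹ S)))

  indicator : Bool → ℚ
  indicator true  = 1ℚ
  indicator false = 0ℚ

  0≤indicator : ∀ b → 0ℚ ≤ indicator b
  0≤indicator true  = 0≤1
  0≤indicator false = ℚ.≤-refl

  indicator-∧ : ∀ b c → indicator (b ∧ c) ≡ indicator b * indicator c
  indicator-∧ true  c = sym (ℚ.*-identityˡ (indicator c))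
  indicator-∧ false c = sym (ℚ.*-zeroˡ (indicator c))

  indicator-not : ∀ b → indicator (not b) ≡ 1ℚ - indicator b
  indicator-not true  = refl
  indicator-not false = refl

  -- The extension property

  -- The wanted vertex is a candidate which is adjacent to all vertices with role
  -- required true and to none with role required false.
  data Role : Set where
    required       : Bool → Role
    candidate idle : Role

  agree : Bool → Bool → Bool
  agree true  b = b
  agree false b = not b

  matches : Vec Role n → Subset n → Bool
  matches []               []      = true
  matches (required c ∷ R) (b ∷ S) = agree c b ∧ matches R S
  matches (_ ∷ R)          (_ ∷ S) = matches R S

  -- The vertices of Ω n are peeled off one by one: a required vertex turns the
  -- candidates that it rules out into idle vertices.
  retain : Bool → Role → Bool → Role
  retain c candidate    b = if agree c b then candidate else idle
  retain c (required d) b = required d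
  retain c idle         b = idle

  survivors : Bool → Vec Role n → Subset n → Vec Role n
  survivors c = zipWith (retain c)

  -- The empty graph gives `true`, as no candidate is left. A candidate is tested when it is peeled
  -- off, against the required vertices still present; those peeled off before it have already made
  -- it idle or retained it.
  fails : Vec Role n → Ω n → Bool
  fails []               ∅       = true
  fails (candidate ∷ R)  (Γ ▹ S) = not (matches R S) ∧ fails R Γ
  fails (required c ∷ R) (Γ ▹ S) = fails (survivors c R S) Γ
  fails (idle ∷ R)       (Γ ▹ S) = fails R Γ

  record Witness (R : Vec Role n) (Γ : Ω n) : Set where
    field
      vertex       : Fin n
      is-candidate : lookup R vertex ≡ candidate
      complies     : ∀ v c → lookup R v ≡ required c → adjacent Γ vertex v ≡ c

  agree⇒≡ : ∀ c b → agree c b ≡ true → b ≡ c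
  agree⇒≡ true  true  _ = refl
  agree⇒≡ false false _ = refl

  matches⇒complies : (R : Vec Role n) (S : Subset n) → matches R S ≡ true →
    ∀ v c → lookup R v ≡ required c → lookup S v ≡ c
  matches⇒complies (required d ∷ R) (b ∷ S) eq v c eq′ with agree d b in agreed
  matches⇒complies (required d ∷ R) (b ∷ S) eq zero    .d refl | true = agree⇒≡ d b agreed
  matches⇒complies (required d ∷ R) (b ∷ S) eq (suc v) c  eq′  | true = matches⇒complies R S eq v c eq′
  matches⇒complies (candidate ∷ R) (_ ∷ S) eq (suc v) c eq′ = matches⇒complies R S eq v c eq′
  matches⇒complies (idle ∷ R)      (_ ∷ S) eq (suc v) c eq′ = matches⇒complies R S eq v c eq′

  survivors-candidate : ∀ c (R : Vec Role n) S v → lookup (survivors c R S) v ≡ candidate →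
    lookup R v ≡ candidate × lookup S v ≡ c
  survivors-candidate c (_ ∷ R) (_ ∷ S) (suc v) eq = survivors-candidate c R S v eq
  survivors-candidate c (candidate ∷ R) (b ∷ S) zero eq with agree c b in agreed
  ... | true = refl , agree⇒≡ c b agreed

  survivors-required : ∀ c (R : Vec Role n) S v {d} →
    lookup R v ≡ required d → lookup (survivors c R S) v ≡ required d
  survivors-required c (_ ∷ R)          (_ ∷ S) (suc v) eq = survivors-required c R S v eq
  survivors-required c (required _ ∷ R) (_ ∷ S) zero    eq = eq

  ¬fails⇒witness : (R : Vec Role n) (Γ : Ω n) → fails R Γ ≡ false → Witness R Γ
  ¬fails⇒witness [] ∅ ()
  ¬fails⇒witness (required c ∷ R) (Γ ▹ S) eq =
    let candidate-R , agrees-S = survivors-candidate c R S vertex is-candidate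
    in record
    { vertex       = suc vertex
    ; is-candidate = candidate-R
    ; complies     = λ { zero _ refl → agrees-S
                       ; (suc v) d eq → complies v d (survivors-required c R S v eq) } }
    where open Witness (¬fails⇒witness (survivors c R S) Γ eq)
  ¬fails⇒witness (idle ∷ R) (Γ ▹ S) eq = record
    { vertex       = suc vertex
    ; is-candidate = is-candidate
    ; complies     = λ { (suc v) → complies v } }
    where open Witness (¬fails⇒witness R Γ eq)
  ¬fails⇒witness (candidate ∷ R) (Γ ▹ S) eq with matches R S in matching
  ... | true  = record
    { vertex       = zero
    ; is-candidate = refl
    ; complies     = λ { (suc v) → matches⇒complies R S matching v } }
  ... | false = record
    { vertex       = suc vertex
    ; is-candidate = is-candidate
    ; complies     = λ { (suc v) → complies v } }
    where open Witness (¬fails⇒witness R Γ eq)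

  -- The probability that every candidate fails

  chance : ℚ → Bool → ℚ
  chance q c = if c then q else 1ℚ - q

  -- The probability that one fixed candidate meets all requirements.
  success : ℚ → Vec Role n → ℚ
  success q []               = 1ℚ
  success q (required c ∷ R) = chance q c * success q R
  success q (candidate ∷ R)  = success q R
  success q (idle ∷ R)       = success q R

  candidates : Vec Role n → ℕ
  candidates []               = 0
  candidates (required _ ∷ R) = candidates R
  candidates (candidate ∷ R)  = suc (candidates R)
  candidates (idle ∷ R)       = candidates R

  -- Candidates may only turn into idle vertices, and neither kind contributes a factor.
  success-survivors : ∀ q c (R : Vec Role n) S → success q (survivors c R S) ≡ success q R
  success-survivors q c []               []      = refl
  success-survivors q c (required d ∷ R) (b ∷ S) = cong (chance q d *_) (success-survivors q c R S)
  success-survivors q c (idle ∷ R)       (b ∷ S) = success-survivors q c R S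
  success-survivors q c (candidate ∷ R)  (b ∷ S) with agree c b
  ... | true  = success-survivors q c R S
  ... | false = success-survivors q c R S

  𝔼-coin-retain : ∀ q c y →
    𝔼-coin q (λ b → if agree c b then y else 1ℚ) ≡ 1ℚ - chance q c * (1ℚ - y)
  𝔼-coin-retain q true = solve 2 (λ q y →
    q :* y :+ (con 1ℚ :- q) :* con 1ℚ := con 1ℚ :- q :* (con 1ℚ :- y)) refl q
  𝔼-coin-retain q false = solve 2 (λ q y →
    q :* con 1ℚ :+ (con 1ℚ :- q) :* y := con 1ℚ :- (con 1ℚ :- q) :* (con 1ℚ :- y)) refl q

  𝔼-coin-agree : ∀ q c → 𝔼-coin q (indicator ∘ agree c) ≡ chance q c
  𝔼-coin-agree q true = solve 1 (λ q →
    q :* con 1ℚ :+ (con 1ℚ :- q) :* con 0ℚ := q) refl q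
  𝔼-coin-agree q false = solve 1 (λ q →
    q :* con 0ℚ :+ (con 1ℚ :- q) :* con 1ℚ := con 1ℚ :- q) refl q

  module _ {E : (A → ℚ) → ℚ} (e : IsExpectation E) where

    -- Fubini: `outcomes` has the smaller graph outermost, `𝔼` the neighbourhood of the new vertex,
    -- and `sumˡ-outcomes` has to exchange the two.
    𝔼-subset-swap : ∀ n q (f : A → Subset n → ℚ) →
      E (λ x → 𝔼-subset n q (f x)) ≡ 𝔼-subset n q (λ S → E (λ x → f x S))
    𝔼-subset-swap zero    q f = refl
    𝔼-subset-swap (suc n) q f = trans (additive e _ _) (cong₂ _+_
      (trans (homogeneous e q _) (cong (q *_) (𝔼-subset-swap n q (λ x S → f x (true ∷ S)))))
      (trans (homogeneous e (1ℚ - q) _) (cong ((1ℚ - q) *_) (𝔼-subset-swap n q (λ x S → f x (false ∷ S))))))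

    𝔼-sum : (f : A → Fin n → ℚ) → E (λ x → sum (f x)) ≡ sum (λ j → E (λ x → f x j))
    𝔼-sum {zero}  f = constant e 0ℚ
    𝔼-sum {suc n} f = trans (additive e (λ x → f x zero) (λ x → sum (f x ∘ suc)))
      (cong (E (λ x → f x zero) +_) (𝔼-sum (λ x → f x ∘ suc)))

  module _ {q : ℚ} (0≤q : 0ℚ ≤ q) (q≤1 : q ≤ 1ℚ) where

    0≤chance : ∀ c → 0ℚ ≤ chance q c
    0≤chance true  = 0≤q
    0≤chance false = 0≤q-p q≤1

    chance≤1 : ∀ c → chance q c ≤ 1ℚ
    chance≤1 true  = q≤1
    chance≤1 false = ≤-by-difference q 0≤q (lemma q)
      where
      lemma : ∀ q → (1ℚ - q) + q ≡ 1ℚ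
      lemma = solve 1 (λ q → (con 1ℚ :- q) :+ q := con 1ℚ) refl

    0≤success : (R : Vec Role n) → 0ℚ ≤ success q R
    0≤success []               = 0≤1
    0≤success (required c ∷ R) = 0≤p*q (0≤chance c) (0≤success R)
    0≤success (candidate ∷ R)  = 0≤success R
    0≤success (idle ∷ R)       = 0≤success R

    success≤1 : (R : Vec Role n) → success q R ≤ 1ℚ
    success≤1 []               = ℚ.≤-refl
    success≤1 (required c ∷ R) = *-mono-≤ (0≤chance c) 0≤1 (chance≤1 c) (success≤1 R)
    success≤1 (candidate ∷ R)  = success≤1 R
    success≤1 (idle ∷ R)       = success≤1 R

    𝔼-coin-isExpectation : IsExpectation (𝔼-coin q)
    𝔼-coin-isExpectation = record
      { mono = λ f≤g → ℚ.+-mono-≤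
          (ℚ.*-monoˡ-≤-nonNeg q {{ℚ.nonNegative 0≤q}} (f≤g true))
          (ℚ.*-monoˡ-≤-nonNeg (1ℚ - q) {{ℚ.nonNegative (0≤q-p q≤1)}} (f≤g false))
      ; additive = λ f g → solve 5 (λ q a b c d →
          q :* (a :+ b) :+ (con 1ℚ :- q) :* (c :+ d) :=
          (q :* a :+ (con 1ℚ :- q) :* c) :+ (q :* b :+ (con 1ℚ :- q) :* d))
          refl q (f true) (g true) (f false) (g false)
      ; homogeneous = λ c f → solve 4 (λ q c a b →
          q :* (c :* a) :+ (con 1ℚ :- q) :* (c :* b) := c :* (q :* a :+ (con 1ℚ :- q) :* b))
          refl q c (f true) (f false)
      ; total = solve 1 (λ q → q :* con 1ℚ :+ (con 1ℚ :- q) :* con 1ℚ := con 1ℚ) refl q }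

    𝔼-subset-isExpectation : ∀ n → IsExpectation (𝔼-subset n q)
    𝔼-subset-isExpectation zero    = dirac []
    𝔼-subset-isExpectation (suc n) = iterated 𝔼-coin-isExpectation (𝔼-subset-isExpectation n) _∷_

    𝔼-isExpectation : ∀ n → IsExpectation (𝔼 n q)
    𝔼-isExpectation zero    = dirac ∅
    𝔼-isExpectation (suc n) = iterated (𝔼-subset-isExpectation n) (𝔼-isExpectation n) (λ S Γ → Γ ▹ S)

    𝔼-iterated-product : {E : (A → ℚ) → ℚ} {F : (B → ℚ) → ℚ} → IsExpectation E → IsExpectation F →
      {f : A → B → ℚ} (u : A → ℚ) (g : B → ℚ) → (∀ x y → f x y ≡ u x * g y) → E (λ x → F (f x)) ≡ E u * F g
    𝔼-iterated-product {F = F} e f′ u g f≡u*g = trans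
      (cong-≗ e (λ x → trans (cong-≗ f′ (f≡u*g x)) (homogeneous f′ (u x) g)))
      (homogeneousʳ e u (F g))

    𝔼-matches : (R : Vec Role n) → 𝔼-subset n q (indicator ∘ matches R) ≡ success q R
    𝔼-matches []               = refl
    𝔼-matches (required c ∷ R) = trans
      (𝔼-iterated-product 𝔼-coin-isExpectation (𝔼-subset-isExpectation _)
        (indicator ∘ agree c) (indicator ∘ matches R)
        (λ b S → indicator-∧ (agree c b) (matches R S)))
      (cong₂ _*_ (𝔼-coin-agree q c) (𝔼-matches R))
    𝔼-matches (candidate ∷ R)  = trans (constant 𝔼-coin-isExpectation _) (𝔼-matches R)
    𝔼-matches (idle ∷ R)       = trans (constant 𝔼-coin-isExpectation _) (𝔼-matches R)

    -- The binomial theorem, as each candidate survives independently.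
    𝔼-survivors : ∀ c y (R : Vec Role n) →
      𝔼-subset n q (λ S → y ^ candidates (survivors c R S)) ≡
      (1ℚ - chance q c * (1ℚ - y)) ^ candidates R
    𝔼-survivors c y [] = refl
    𝔼-survivors c y (required _ ∷ R) = trans (constant 𝔼-coin-isExpectation _) (𝔼-survivors c y R)
    𝔼-survivors c y (idle ∷ R) = trans (constant 𝔼-coin-isExpectation _) (𝔼-survivors c y R)
    𝔼-survivors c y (candidate ∷ R) = trans
      (𝔼-iterated-product 𝔼-coin-isExpectation (𝔼-subset-isExpectation _)
        (λ b → if agree c b then y else 1ℚ) (λ S → y ^ candidates (survivors c R S))
        (λ b S → factor (agree c b) (survivors c R S)))
      (cong₂ _*_ (𝔼-coin-retain q c y) (𝔼-survivors c y R))
      where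
      factor : ∀ b (R : Vec Role n) →
        y ^ candidates ((if b then candidate else idle) ∷ R) ≡
        (if b then y else 1ℚ) * y ^ candidates R
      factor true  R = refl
      factor false R = sym (ℚ.*-identityˡ _)

    -- Distinct candidates use disjoint sets of edges to the required vertices, hence fail
    -- independently. A required vertex in front thins out the candidates: each survives with
    -- probability `chance q c` and then succeeds with probability `success q R`.
    𝔼-fails : (R : Vec Role n) →
      𝔼 n q (indicator ∘ fails R) ≡ (1ℚ - success q R) ^ candidates R
    𝔼-fails [] = refl
    𝔼-fails {suc n} (required c ∷ R) = begin
      𝔼-subset n q (λ S → 𝔼 n q (indicator ∘ fails (survivors c R S)))
        ≡⟨ cong-≗ (𝔼-subset-isExpectation n) (λ S → trans (𝔼-fails (survivors c R S))
             (cong (λ z → (1ℚ - z) ^ candidates (survivors c R S)) (success-survivors q c R S))) ⟩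
      𝔼-subset n q (λ S → (1ℚ - success q R) ^ candidates (survivors c R S))
        ≡⟨ 𝔼-survivors c (1ℚ - success q R) R ⟩
      (1ℚ - chance q c * (1ℚ - (1ℚ - success q R))) ^ candidates R
        ≡⟨ cong (_^ candidates R) (cancel (chance q c) (success q R)) ⟩
      (1ℚ - chance q c * success q R) ^ candidates R ∎
      where
      open ≡-Reasoning
      cancel : ∀ a b → 1ℚ - a * (1ℚ - (1ℚ - b)) ≡ 1ℚ - a * b
      cancel = solve 2 (λ a b → con 1ℚ :- a :* (con 1ℚ :- (con 1ℚ :- b)) := con 1ℚ :- a :* b) refl
    𝔼-fails {suc n} (candidate ∷ R) = trans
      (𝔼-iterated-product (𝔼-subset-isExpectation n) (𝔼-isExpectation n)
        (indicator ∘ not ∘ matches R) (indicator ∘ fails R)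
        (λ S Γ → indicator-∧ (not (matches R S)) (fails R Γ)))
      (cong₂ _*_
        (trans (cong-≗ (𝔼-subset-isExpectation n) (λ S → indicator-not (matches R S)))
          (trans (complement (𝔼-subset-isExpectation n) (indicator ∘ matches R))
            (cong (1ℚ -_) (𝔼-matches R))))
        (𝔼-fails R))
    𝔼-fails {suc n} (idle ∷ R) = trans (constant (𝔼-subset-isExpectation n) _) (𝔼-fails R)

  -- Opaque, as unification would otherwise unfold the normalisation of
  -- fractions.
  opaque
    ι : ℕ → ℚ
    ι n = ℤ.+ n ℚ./ 1

    ι-fraction : ∀ n → ι n ≡ ℤ.+ n ℚ./ 1
    ι-fraction n = refl

    ι-+ : ∀ m n → ι (m ℕ.+ n) ≡ ι m + ι n
    ι-+ m n = ℚ.toℚᵘ-injective (begin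
      ℚ.toℚᵘ (ι (m ℕ.+ n))                       ≈⟨ ℚ.toℚᵘ-fromℚᵘ (ℚᵘ.mkℚᵘ (ℤ.+ (m ℕ.+ n)) 0) ⟩
      ℚᵘ.mkℚᵘ (ℤ.+ (m ℕ.+ n)) 0                  ≡⟨ cong (λ z → ℚᵘ.mkℚᵘ z 0)
        (sym (cong₂ ℤ._+_ (ℤ.*-identityʳ (ℤ.+ m)) (ℤ.*-identityʳ (ℤ.+ n)))) ⟩
      ℚᵘ.mkℚᵘ (ℤ.+ m) 0 ℚᵘ.+ ℚᵘ.mkℚᵘ (ℤ.+ n) 0  ≈⟨ ℚᵘ.+-cong
        (ℚ.toℚᵘ-fromℚᵘ (ℚᵘ.mkℚᵘ (ℤ.+ m) 0)) (ℚ.toℚᵘ-fromℚᵘ (ℚᵘ.mkℚᵘ (ℤ.+ n) 0)) ⟨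
      ℚ.toℚᵘ (ι m) ℚᵘ.+ ℚ.toℚᵘ (ι n)             ≈⟨ ℚ.toℚᵘ-homo-+ (ι m) (ι n) ⟨
      ℚ.toℚᵘ (ι m + ι n)                         ∎)
      where open SetoidReasoning ℚᵘ.≃-setoid

  ι-0 : ι 0 ≡ 0ℚ
  ι-0 = ι-fraction 0

  ι-1 : ι 1 ≡ 1ℚ
  ι-1 = ι-fraction 1

  ι-suc : ∀ n → ι (suc n) ≡ 1ℚ + ι n
  ι-suc n = trans (ι-+ 1 n) (cong (_+ ι n) ι-1)

  ι-* : ∀ m n → ι (m ℕ.* n) ≡ ι m * ι n
  ι-* zero    n = trans ι-0 (trans (sym (ℚ.*-zeroˡ (ι n))) (cong (_* ι n) (sym ι-0)))
  ι-* (suc m) n = begin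
    ι (n ℕ.+ m ℕ.* n)    ≡⟨ ι-+ n (m ℕ.* n) ⟩
    ι n + ι (m ℕ.* n)    ≡⟨ cong (ι n +_) (ι-* m n) ⟩
    ι n + ι m * ι n      ≡⟨ solve 2 (λ m n → n :+ m :* n := (con 1ℚ :+ m) :* n) refl (ι m) (ι n) ⟩
    (1ℚ + ι m) * ι n     ≡⟨ cong (_* ι n) (sym (ι-suc m)) ⟩
    ι (suc m) * ι n      ∎
    where open ≡-Reasoning

  ι-^ : ∀ m n → ι (m ℕ.^ n) ≡ ι m ^ n
  ι-^ m zero    = ι-1
  ι-^ m (suc n) = trans (ι-* m (m ℕ.^ n)) (cong (ι m *_) (ι-^ m n))

  0≤ι : ∀ n → 0ℚ ≤ ι n
  0≤ι zero    = ℚ.≤-reflexive (sym ι-0)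
  0≤ι (suc n) = subst (0ℚ ≤_) (sym (ι-suc n)) (ℚ.+-mono-≤ 0≤1 (0≤ι n))

  ι-mono-≤ : m ℕ.≤ n → ι m ≤ ι n
  ι-mono-≤ {m} {n} m≤n = ≤-by-difference (ι (n ℕ.∸ m)) (0≤ι (n ℕ.∸ m))
    (trans (sym (ι-+ m (n ℕ.∸ m))) (cong ι (ℕ.m+[n∸m]≡n m≤n)))

  archimedean : ∀ p {ε} → 0ℚ ℚ.< ε → ∃[ N ] (∀ n → N ℕ.≤ n → p ≤ ι n * ε)
  archimedean p {ε} 0<ε = ℤ.∣ ℚ.↥ r ∣ , λ n N≤n → subst (_≤ ι n * ε) rε≡p
    (ℚ.*-monoʳ-≤-nonNeg ε {{ℚ.pos⇒nonNeg ε}} (ℚ.≤-trans (r≤N r) (ι-mono-≤ N≤n)))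
    where
    instance
      ε⁺ = ℚ.positive 0<ε
      ε≢0 = ℚ.pos⇒nonZero ε
    r = p * ℚ.1/ ε
    rε≡p : r * ε ≡ p
    rε≡p = trans (ℚ.*-assoc p (ℚ.1/ ε) ε)
      (trans (cong (p *_) (ℚ.*-inverseˡ ε)) (ℚ.*-identityʳ p))
    -- The denominator is at least 1, so the absolute value of the numerator bounds `r`.
    r≤N : ∀ r → r ≤ ι ℤ.∣ ℚ.↥ r ∣
    r≤N r@(ℚ.mkℚ i d _) = subst (r ≤_) (sym (ι-fraction ℤ.∣ i ∣)) (ℚ.toℚᵘ-cancel-≤ (ℚᵘ.≤-respʳ-≃
      (ℚᵘ.≃-sym (ℚ.toℚᵘ-fromℚᵘ (ℚᵘ.mkℚᵘ (ℤ.+ ℤ.∣ i ∣) 0)))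
      (ℚᵘ.*≤* (ℤ.≤-trans (ℤ.≤-reflexive (ℤ.*-identityʳ i)) (i≤ i)))))
      where
      i≤ : ∀ i → i ℤ.≤ ℤ.+ ℤ.∣ i ∣ ℤ.* ℤ.+ suc d
      i≤ (ℤ.+ k)      = subst (ℤ.+ k ℤ.≤_) (ℤ.pos-* k (suc d)) (ℤ.+≤+ (ℕ.m≤m*n k (suc d)))
      i≤ (ℤ.-[1+ k ]) = subst (ℤ.-[1+ k ] ℤ.≤_) (ℤ.pos-* (suc k) (suc d)) ℤ.-≤+

  -- Sums over vertices

  sum-≤ : (f : Fin n → ℚ) {c : ℚ} → (∀ v → f v ≤ c) → sum f ≤ ι n * c
  sum-≤ {zero}  f {c} f≤c = ℚ.≤-reflexive (trans (sym (ℚ.*-zeroˡ c)) (cong (_* c) (sym ι-0)))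
  sum-≤ {suc n} f {c} f≤c = subst (sum f ≤_)
    (trans (solve 2 (λ n c → c :+ n :* c := (con 1ℚ :+ n) :* c) refl (ι n) c)
      (cong (_* c) (sym (ι-suc n))))
    (ℚ.+-mono-≤ (f≤c zero) (sum-≤ (f ∘ suc) (f≤c ∘ suc)))

  0≤sum : (f : Fin n → ℚ) → (∀ v → 0ℚ ≤ f v) → 0ℚ ≤ sum f
  0≤sum {zero}  f 0≤f = ℚ.≤-refl
  0≤sum {suc n} f 0≤f = ℚ.+-mono-≤ (0≤f zero) (0≤sum (f ∘ suc) (0≤f ∘ suc))

  -- The pointwise form of the union bound: one large term makes a sum of nonnegative terms large.
  1≤sum⊎∀ : {P : Fin n → Set} (f : Fin n → ℚ) → (∀ v → 0ℚ ≤ f v) →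
    (∀ v → 1ℚ ≤ f v ⊎ P v) → 1ℚ ≤ sum f ⊎ (∀ v → P v)
  1≤sum⊎∀ {zero}  f 0≤f large⊎P = inj₂ λ ()
  1≤sum⊎∀ {suc n} f 0≤f large⊎P with large⊎P zero | 1≤sum⊎∀ (f ∘ suc) (0≤f ∘ suc) (large⊎P ∘ suc)
  ... | inj₁ large | _          = inj₁ (ℚ.+-mono-≤ large (0≤sum (f ∘ suc) (0≤f ∘ suc)))
  ... | inj₂ _     | inj₁ large = inj₁ (ℚ.+-mono-≤ (0≤f zero) large)
  ... | inj₂ p     | inj₂ ps    = inj₂ λ { zero → p ; (suc v) → ps v }

  -- The union bound

  require : Vec Role n → Vec (Fin n) m → Vec Role n
  require R []       = R
  require R (v ∷ vs) = require (R [ v ]≔ required true) vs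

  -- Counts the lists of `m` vertices for which the search fails. All lists are included, also those
  -- with repetitions or with entries that overwrite a role `required false`.
  failures : (m : ℕ) → Vec Role n → Ω n → ℚ
  failures zero    R Γ = indicator (fails R Γ)
  failures (suc m) R Γ = sum (λ v → failures m (R [ v ]≔ required true) Γ)

  avoiding : Fin n → Vec Role n
  avoiding {n} v = replicate n candidate [ v ]≔ required false

  allFailures : (m : ℕ) → Ω n → ℚ
  allFailures m Γ = sum (λ v → failures m (avoiding v) Γ)

  0≤failures : ∀ m (R : Vec Role n) Γ → 0ℚ ≤ failures m R Γ
  0≤failures zero    R Γ = 0≤indicator (fails R Γ)
  0≤failures (suc m) R Γ = 0≤sum (λ v → failures m (R [ v ]≔ required true) Γ)
    λ v → 0≤failures m (R [ v ]≔ required true) Γ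

  0≤allFailures : ∀ m (Γ : Ω n) → 0ℚ ≤ allFailures m Γ
  0≤allFailures m Γ = 0≤sum (λ v → failures m (avoiding v) Γ) λ v → 0≤failures m (avoiding v) Γ

  1≤failures⊎witness : ∀ (m : ℕ) (R : Vec Role n) Γ →
    1ℚ ≤ failures m R Γ ⊎ (∀ (vs : Vec (Fin n) m) → Witness (require R vs) Γ)
  1≤failures⊎witness zero R Γ with fails R Γ in failed
  ... | true  = inj₁ ℚ.≤-refl
  ... | false = inj₂ λ { [] → ¬fails⇒witness R Γ failed }
  1≤failures⊎witness (suc m) R Γ
    with 1≤sum⊎∀ _ (λ v → 0≤failures m (R [ v ]≔ required true) Γ)
                    (λ v → 1≤failures⊎witness m (R [ v ]≔ required true) Γ)
  ... | inj₁ large = inj₁ large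
  ... | inj₂ w     = inj₂ λ { (v ∷ vs) → w v vs }

  1≤allFailures⊎witness : ∀ m (Γ : Ω n) → 1ℚ ≤ allFailures m Γ ⊎
    (∀ v (vs : Vec (Fin n) m) → Witness (require (avoiding v) vs) Γ)
  1≤allFailures⊎witness m Γ = 1≤sum⊎∀ _ (λ v → 0≤failures m (avoiding v) Γ)
    (λ v → 1≤failures⊎witness m (avoiding v) Γ)

  candidates-≔ : (R : Vec Role n) (v : Fin n) (c : Bool) →
    candidates R ℕ.≤ suc (candidates (R [ v ]≔ required c))
  candidates-≔ (candidate ∷ R)  zero    c = ℕ.≤-refl
  candidates-≔ (required _ ∷ R) zero    c = ℕ.n≤1+n _
  candidates-≔ (idle ∷ R)       zero    c = ℕ.n≤1+n _
  candidates-≔ (candidate ∷ R)  (suc v) c = ℕ.s≤s (candidates-≔ R v c)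
  candidates-≔ (required _ ∷ R) (suc v) c = candidates-≔ R v c
  candidates-≔ (idle ∷ R)       (suc v) c = candidates-≔ R v c

  candidates-replicate : ∀ n → candidates (replicate n candidate) ≡ n
  candidates-replicate zero    = refl
  candidates-replicate (suc n) = cong suc (candidates-replicate n)

  success-replicate : ∀ q n → success q (replicate n candidate) ≡ 1ℚ
  success-replicate q zero    = refl
  success-replicate q (suc n) = success-replicate q n

  module _ {q : ℚ} (0≤q : 0ℚ ≤ q) (q≤1 : q ≤ 1ℚ) where

    -- The two sides agree unless `v` already carries a requirement; overwriting that one drops a
    -- factor of at most 1.
    success-≔ : (R : Vec Role n) (v : Fin n) (c : Bool) →
      chance q c * success q R ≤ success q (R [ v ]≔ required c)
    success-≔ (required d ∷ R) zero c =
      ℚ.*-monoˡ-≤-nonNeg (chance q c) {{ℚ.nonNegative (0≤chance 0≤q q≤1 c)}}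
        (≤-respʳ-≡ (ℚ.*-identityˡ (success q R))
          (ℚ.*-monoʳ-≤-nonNeg (success q R) {{ℚ.nonNegative (0≤success 0≤q q≤1 R)}}
            (chance≤1 0≤q q≤1 d)))
    success-≔ (candidate ∷ R) zero c = ℚ.≤-refl
    success-≔ (idle ∷ R)      zero c = ℚ.≤-refl
    success-≔ (required d ∷ R) (suc v) c = ≤-respˡ-≡
      (solve 3 (λ a b s → b :* (a :* s) := a :* (b :* s)) refl (chance q c) (chance q d) (success q R))
      (ℚ.*-monoˡ-≤-nonNeg (chance q d) {{ℚ.nonNegative (0≤chance 0≤q q≤1 d)}} (success-≔ R v c))
    success-≔ (candidate ∷ R) (suc v) c = success-≔ R v c
    success-≔ (idle ∷ R)      (suc v) c = success-≔ R v c

    -- Each of the `m` entries to come multiplies the number of choices by `n`, costs at most one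
    -- candidate, and costs at most a factor `q` of the success probability. So `x` and `s` are
    -- lower bounds for success probability and candidates after the last entry, where `𝔼-fails`
    -- applies.
    𝔼-failures : ∀ m (R : Vec Role n) {x s} → 0ℚ ≤ x → x ≤ q ^ m * success q R →
      s ℕ.+ m ℕ.≤ candidates R → 𝔼 n q (failures m R) ≤ ι n ^ m * (1ℚ - x) ^ s
    𝔼-failures {n} zero R {x} {s} 0≤x x≤success s≤candidates = begin
      𝔼 n q (indicator ∘ fails R)          ≡⟨ 𝔼-fails 0≤q q≤1 R ⟩
      (1ℚ - ρ) ^ candidates R              ≤⟨ ^-antimonoʳ-≤ (0≤q-p (success≤1 0≤q q≤1 R)) 1-ρ≤1 (ℕ.≤-trans (ℕ.≤-reflexive (sym (ℕ.+-identityʳ s))) s≤candidates) ⟩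
      (1ℚ - ρ) ^ s                         ≤⟨ ^-monoˡ-≤ (0≤q-p (success≤1 0≤q q≤1 R)) (ℚ.+-monoʳ-≤ 1ℚ (ℚ.neg-antimono-≤ x≤ρ)) s ⟩
      (1ℚ - x) ^ s                         ≡⟨ ℚ.*-identityˡ _ ⟨
      1ℚ * (1ℚ - x) ^ s                    ∎
      where
      open ℚ.≤-Reasoning
      ρ = success q R
      x≤ρ : x ≤ ρ
      x≤ρ = subst (x ≤_) (ℚ.*-identityˡ ρ) x≤success
      1-ρ≤1 : 1ℚ - ρ ≤ 1ℚ
      1-ρ≤1 = ≤-by-difference ρ (0≤success 0≤q q≤1 R)
        (solve 1 (λ r → (con 1ℚ :- r) :+ r := con 1ℚ) refl ρ)
    𝔼-failures {n} (suc m) R {x} {s} 0≤x x≤success s≤candidates = begin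
      𝔼 n q (failures (suc m) R)           ≡⟨ 𝔼-sum (𝔼-isExpectation 0≤q q≤1 n) (λ Γ v → failures m (R′ v) Γ) ⟩
      sum (λ v → 𝔼 n q (failures m (R′ v)))  ≤⟨ sum-≤ _ (λ v → 𝔼-failures m (R′ v) 0≤x (x≤ v) (s≤ v)) ⟩
      ι n * (ι n ^ m * (1ℚ - x) ^ s)       ≡⟨ ℚ.*-assoc (ι n) (ι n ^ m) _ ⟨
      ι n ^ suc m * (1ℚ - x) ^ s           ∎
      where
      open ℚ.≤-Reasoning
      R′ : Fin n → Vec Role n
      R′ v = R [ v ]≔ required true
      x≤ : ∀ v → x ≤ q ^ m * success q (R′ v)
      x≤ v = ℚ.≤-trans x≤success (≤-respˡ-≡
        (solve 3 (λ a b c → b :* (a :* c) := (a :* b) :* c) refl q (q ^ m) (success q R))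
        (ℚ.*-monoˡ-≤-nonNeg (q ^ m) {{ℚ.nonNegative (0≤p^n 0≤q m)}} (success-≔ R v true)))
      s≤ : ∀ v → s ℕ.+ m ℕ.≤ candidates (R′ v)
      s≤ v = ℕ.s≤s⁻¹ (ℕ.≤-trans (ℕ.≤-reflexive (sym (ℕ.+-suc s m))) (ℕ.≤-trans s≤candidates (candidates-≔ R v true)))

    -- The forbidden vertex accounts for one more factor `n`, the factor `1ℚ - q` and one lost
    -- candidate.
    𝔼-allFailures : ∀ m {x s} → 0ℚ ≤ x → x ≤ q ^ m * (1ℚ - q) → s ℕ.+ suc m ℕ.≤ n →
      𝔼 n q (allFailures m) ≤ ι n ^ suc m * (1ℚ - x) ^ s
    𝔼-allFailures {n} m {x} {s} 0≤x x≤ s≤ = begin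
      𝔼 n q (allFailures m)              ≡⟨ 𝔼-sum (𝔼-isExpectation 0≤q q≤1 n) (λ Γ v → failures m (avoiding v) Γ) ⟩
      sum (λ v → 𝔼 n q (failures m (avoiding v)))  ≤⟨ sum-≤ _ (λ v → 𝔼-failures m (avoiding v) 0≤x (x≤′ v) (s≤′ v)) ⟩
      ι n * (ι n ^ m * (1ℚ - x) ^ s)       ≡⟨ ℚ.*-assoc (ι n) (ι n ^ m) _ ⟨
      ι n ^ suc m * (1ℚ - x) ^ s           ∎
      where
      open ℚ.≤-Reasoning
      x≤′ : ∀ v → x ≤ q ^ m * success q (avoiding v)
      x≤′ v = ℚ.≤-trans x≤ (ℚ.*-monoˡ-≤-nonNeg (q ^ m) {{ℚ.nonNegative (0≤p^n 0≤q m)}}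
        (≤-respˡ-≡ (trans (cong ((1ℚ - q) *_) (success-replicate q n)) (ℚ.*-identityʳ _))
          (success-≔ (replicate n candidate) v false)))
      s≤′ : ∀ v → s ℕ.+ m ℕ.≤ candidates (avoiding v)
      s≤′ v = ℕ.s≤s⁻¹ (ℕ.≤-trans (ℕ.≤-reflexive (sym (ℕ.+-suc s m))) (ℕ.≤-trans s≤
        (ℕ.≤-trans (ℕ.≤-reflexive (sym (candidates-replicate n))) (candidates-≔ (replicate n candidate) v false))))

  -- Decay of the failure probability

  module _ {x : ℚ} (0≤x : 0ℚ ≤ x) (x≤1 : x ≤ 1ℚ) where

    -- Induction on `s`: (1 - x)(1 + (s + 1)x) falls short of 1 + sx by (s + 1)x².
    [1-x]^s*[1+sx]≤1 : ∀ s → (1ℚ - x) ^ s * (1ℚ + ι s * x) ≤ 1ℚ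
    [1-x]^s*[1+sx]≤1 zero = ℚ.≤-reflexive (trans (cong (λ z → 1ℚ * (1ℚ + z * x)) ι-0)
      (solve 1 (λ x → con 1ℚ :* (con 1ℚ :+ con 0ℚ :* x) := con 1ℚ) refl x))
    [1-x]^s*[1+sx]≤1 (suc s) = ℚ.≤-trans
      (≤-by-difference (y * ((1ℚ + ι s) * (x * x)))
        (0≤p*q (0≤p^n (0≤q-p x≤1) s) (0≤p*q (ℚ.+-mono-≤ 0≤1 (0≤ι s)) (0≤p*q 0≤x 0≤x)))
        (trans (cong (λ z → (1ℚ - x) * y * (1ℚ + z * x) + y * ((1ℚ + ι s) * (x * x))) (ι-suc s))
          (identity x y (ι s))))
      ([1-x]^s*[1+sx]≤1 s)
      where
      y = (1ℚ - x) ^ s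
      identity : ∀ x y s → (1ℚ - x) * y * (1ℚ + (1ℚ + s) * x) + y * ((1ℚ + s) * (x * x)) ≡ y * (1ℚ + s * x)
      identity = solve 3 (λ x y s →
        (con 1ℚ :- x) :* y :* (con 1ℚ :+ (con 1ℚ :+ s) :* x) :+ y :* ((con 1ℚ :+ s) :* (x :* x))
        := y :* (con 1ℚ :+ s :* x)) refl

    [1-x]^s*sx≤1 : ∀ s → (1ℚ - x) ^ s * (ι s * x) ≤ 1ℚ
    [1-x]^s*sx≤1 s = ℚ.≤-trans
      (ℚ.*-monoˡ-≤-nonNeg ((1ℚ - x) ^ s) {{ℚ.nonNegative (0≤p^n (0≤q-p x≤1) s)}}
        (≤-by-difference 1ℚ 0≤1 (ℚ.+-comm (ι s * x) 1ℚ)))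
      ([1-x]^s*[1+sx]≤1 s)

  1≤p^n : ∀ {p} → 1ℚ ≤ p → ∀ n → 1ℚ ≤ p ^ n
  1≤p^n 1≤p zero    = ℚ.≤-refl
  1≤p^n 1≤p (suc n) = *-mono-≤ 0≤1 (ℚ.≤-trans 0≤1 (1≤p^n 1≤p n)) 1≤p (1≤p^n 1≤p n)

  ^-swap : ∀ p a b → (p ^ a) ^ b ≡ (p ^ b) ^ a
  ^-swap p a b = trans (^-assocʳ p a b) (trans (cong (p ^_) (ℕ.*-comm a b)) (sym (^-assocʳ p b a)))

  -- The product of b = ma + 1 and t = m + 2. The power n^t consists of the n^(m + 1) choices in the
  -- union bound and one more factor n, which leaves a bound of order 1/n.
  exponent : ℕ → ℕ → ℕ
  exponent m a = suc (m ℕ.* a) ℕ.* (2 ℕ.+ m)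

  -- From N^a q^b ≥ 1 with b = ma + 1: N^(bt) q^(mbt) = N^t (N^a q^b)^(mt).
  power-gain : ∀ {N q} m a → 0ℚ ≤ N → 1ℚ ≤ N ^ a * q ^ suc (m ℕ.* a) →
    N ^ (2 ℕ.+ m) ≤ (N * q ^ m) ^ exponent m a
  power-gain {N} {q} m a 0≤N 1≤N^a*q^b = begin
    N ^ t                                     ≡⟨ ℚ.*-identityʳ (N ^ t) ⟨
    N ^ t * 1ℚ                                ≤⟨ ℚ.*-monoˡ-≤-nonNeg (N ^ t) {{ℚ.nonNegative (0≤p^n 0≤N t)}} (1≤p^n 1≤N^a*q^b (m ℕ.* t)) ⟩
    N ^ t * (N ^ a * q ^ b) ^ (m ℕ.* t)       ≡⟨ cong (N ^ t *_) (^-distrib-* (N ^ a) (q ^ b) (m ℕ.* t)) ⟩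
    N ^ t * ((N ^ a) ^ (m ℕ.* t) * (q ^ b) ^ (m ℕ.* t))
      ≡⟨ cong₂ (λ u v → N ^ t * (u * v)) N-power q-power ⟩
    N ^ t * (N ^ (m ℕ.* a ℕ.* t) * (q ^ m) ^ (b ℕ.* t))
      ≡⟨ ℚ.*-assoc (N ^ t) _ _ ⟨
    N ^ t * N ^ (m ℕ.* a ℕ.* t) * (q ^ m) ^ (b ℕ.* t)
      ≡⟨ cong (_* (q ^ m) ^ (b ℕ.* t)) (^-homo-* N t (m ℕ.* a ℕ.* t)) ⟨
    N ^ (b ℕ.* t) * (q ^ m) ^ (b ℕ.* t)       ≡⟨ ^-distrib-* N (q ^ m) (b ℕ.* t) ⟨
    (N * q ^ m) ^ (b ℕ.* t)                   ∎
    where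
    open ℚ.≤-Reasoning
    t = 2 ℕ.+ m
    b = suc (m ℕ.* a)
    N-power : (N ^ a) ^ (m ℕ.* t) ≡ N ^ (m ℕ.* a ℕ.* t)
    N-power = trans (^-assocʳ N a (m ℕ.* t)) (cong (N ^_)
      (trans (sym (ℕ.*-assoc a m t)) (cong (ℕ._* t) (ℕ.*-comm a m))))
    q-power : (q ^ b) ^ (m ℕ.* t) ≡ (q ^ m) ^ (b ℕ.* t)
    q-power = trans (sym (^-assocʳ (q ^ b) m t))
      (trans (cong (_^ t) (^-swap q b m)) (^-assocʳ (q ^ m) b t))

  0<ι : ∀ {n} → 1 ℕ.≤ n → 0ℚ ℚ.< ι n
  0<ι 1≤n = ℚ.<-≤-trans (ℚ.positive⁻¹ 1ℚ) (≤-respˡ-≡ ι-1 (ι-mono-≤ 1≤n))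

  0≤½ : 0ℚ ≤ ½
  0≤½ = ℚ.<⇒≤ (ℚ.positive⁻¹ ½)

  ½≤1 : ½ ≤ 1ℚ
  ½≤1 = ≤-by-difference ½ 0≤½ refl

  4ℚ : ℚ
  4ℚ = ℤ.+ 4 ℚ./ 1

  -- With s = ⌊n / h⌋ the factor (1 - x)^(sk) beats the power (N q^m)^k,
  -- because (1 - x)^s N q^m ≤ 4h.
  𝔼-allFailures-decay : ∀ m k {n q} → suc (k ℕ.+ m) ℕ.≤ n → 0ℚ ≤ q → q ≤ ½ →
    ι n ^ (2 ℕ.+ m) ≤ (ι n * q ^ m) ^ k →
    ι n * 𝔼 n q (allFailures m) ≤ (4ℚ * ι (suc (k ℕ.+ m))) ^ k
  𝔼-allFailures-decay m k {n} {q} h≤n 0≤q q≤½ gain = begin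
    N * 𝔼 n q (allFailures m)
      ≤⟨ ℚ.*-monoˡ-≤-nonNeg N {{ℚ.nonNegative (0≤ι n)}} (𝔼-allFailures 0≤q q≤1 m 0≤x x≤ size) ⟩
    N * (N ^ suc m * (1ℚ - x) ^ (s ℕ.* k))
      ≡⟨ ℚ.*-assoc N (N ^ suc m) _ ⟨
    N ^ (2 ℕ.+ m) * (1ℚ - x) ^ (s ℕ.* k)
      ≤⟨ ℚ.*-monoʳ-≤-nonNeg _ {{ℚ.nonNegative (0≤p^n 0≤1-x (s ℕ.* k))}} gain ⟩
    (N * q ^ m) ^ k * (1ℚ - x) ^ (s ℕ.* k)
      ≡⟨ cong ((N * q ^ m) ^ k *_) (^-assocʳ (1ℚ - x) s k) ⟨
    (N * q ^ m) ^ k * y ^ k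
      ≡⟨ ^-distrib-* (N * q ^ m) y k ⟨
    (N * q ^ m * y) ^ k
      ≤⟨ ^-monoˡ-≤ (0≤p*q (0≤p*q (0≤ι n) (0≤p^n 0≤q m)) 0≤y) N*q^m*y≤ k ⟩
    (4ℚ * ι h) ^ k ∎
    where
    open ℚ.≤-Reasoning
    -- Chosen so that `s * k` candidates and `suc m` vertices with a requirement fit into `n`:
    -- `s * k + suc m ≤ s * h ≤ n`.
    h = suc (k ℕ.+ m)
    N = ι n
    s = n ℕ./ h
    -- A lower bound for the success probability `q ^ m * (1ℚ - q)`, since `q ≤ ½`.
    x = q ^ m * ½
    y = (1ℚ - x) ^ s
    q≤1 = ℚ.≤-trans q≤½ ½≤1
    0≤x : 0ℚ ≤ x
    0≤x = 0≤p*q (0≤p^n 0≤q m) 0≤½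
    x≤1 : x ≤ 1ℚ
    x≤1 = *-mono-≤ (0≤p^n 0≤q m) 0≤1 (^-≤1 0≤q q≤1 m) ½≤1
    x≤ : x ≤ q ^ m * (1ℚ - q)
    x≤ = ℚ.*-monoˡ-≤-nonNeg (q ^ m) {{ℚ.nonNegative (0≤p^n 0≤q m)}}
      (ℚ.+-monoʳ-≤ 1ℚ (ℚ.neg-antimono-≤ q≤½))
    0≤1-x = 0≤q-p x≤1
    0≤y = 0≤p^n 0≤1-x s
    s>0 : 1 ℕ.≤ s
    s>0 = ℕ.m≥n⇒m/n>0 h≤n
    size : s ℕ.* k ℕ.+ suc m ℕ.≤ n
    size = ℕ.≤-trans (ℕ.+-monoʳ-≤ (s ℕ.* k) (ℕ.m≤n*m (suc m) s {{ℕ.>-nonZero s>0}}))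
      (ℕ.≤-trans (ℕ.≤-reflexive (trans (sym (ℕ.*-distribˡ-+ s k (suc m))) (cong (s ℕ.*_) (ℕ.+-suc k m))))
        (ℕ.m/n*n≤m n h))
    -- The remainder of `n` modulo `h` is below `h`, and `h ≤ h * s` as `s` is positive.
    n≤ : n ℕ.≤ h ℕ.* s ℕ.+ h ℕ.* s
    n≤ = ℕ.≤-trans (ℕ.≤-reflexive (ℕ.m≡m%n+[m/n]*n n h))
      (ℕ.+-mono-≤ (ℕ.≤-trans (ℕ.<⇒≤ (ℕ.m%n<n n h)) (ℕ.m≤m*n h s {{ℕ.>-nonZero s>0}}))
        (ℕ.≤-reflexive (ℕ.*-comm s h)))
    N≤ : N ≤ ι h * ι s + ι h * ι s
    N≤ = ℚ.≤-trans (ι-mono-≤ n≤) (ℚ.≤-reflexive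
      (trans (ι-+ (h ℕ.* s) (h ℕ.* s)) (cong₂ _+_ (ι-* h s) (ι-* h s))))
    rearrange : ∀ h s p y → (h * s + h * s) * (p * y) ≡ 4ℚ * h * (y * (s * (p * ½)))
    rearrange = solve 4 (λ h s p y → (h :* s :+ h :* s) :* (p :* y) :=
      con 4ℚ :* h :* (y :* (s :* (p :* con ½)))) refl
    N*q^m*y≤ : N * q ^ m * y ≤ 4ℚ * ι h
    N*q^m*y≤ = begin
      N * q ^ m * y                              ≡⟨ ℚ.*-assoc N (q ^ m) y ⟩
      N * (q ^ m * y)                            ≤⟨ ℚ.*-monoʳ-≤-nonNeg _ {{ℚ.nonNegative (0≤p*q (0≤p^n 0≤q m) 0≤y)}} N≤ ⟩
      (ι h * ι s + ι h * ι s) * (q ^ m * y)      ≡⟨ rearrange (ι h) (ι s) (q ^ m) y ⟩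
      4ℚ * ι h * (y * (ι s * x))                 ≤⟨ ℚ.*-monoˡ-≤-nonNeg (4ℚ * ι h) {{ℚ.nonNegative (0≤p*q (ℚ.<⇒≤ (ℚ.positive⁻¹ 4ℚ)) (0≤ι h))}} ([1-x]^s*sx≤1 0≤x x≤1 s) ⟩
      4ℚ * ι h * 1ℚ                              ≡⟨ ℚ.*-identityʳ _ ⟩
      4ℚ * ι h                                   ∎

  -- The bound on `n` times the expectation depends on `m` and `a` only. The threshold `n₀` has to
  -- be uniform in `q`, which will run through the late approximants of `p n`.
  𝔼-allFailures-small : ∀ m a ε → 0ℚ ℚ.< ε → ∃[ n₀ ] (∀ n → n₀ ℕ.≤ n → ∀ q → 0ℚ ≤ q → q ≤ ½ →
    1ℚ ≤ ι n ^ a * q ^ suc (m ℕ.* a) → 𝔼 n q (allFailures m) ≤ ε)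
  𝔼-allFailures-small m a ε 0<ε =
    let N , bound≤ = archimedean ((4ℚ * ι h) ^ e) 0<ε
    in h ℕ.⊔ N , λ n n₀≤n q 0≤q q≤½ 1≤ →
      let h≤n = ℕ.m⊔n≤o⇒m≤o h N n₀≤n
          N≤n = ℕ.m⊔n≤o⇒n≤o h N n₀≤n
      in ℚ.*-cancelˡ-≤-pos (ι n) {{ℚ.positive (0<ι (ℕ.≤-trans (ℕ.s≤s ℕ.z≤n) h≤n))}}
           (ℚ.≤-trans (𝔼-allFailures-decay m e h≤n 0≤q q≤½ (power-gain m a (0≤ι n) 1≤)) (bound≤ n N≤n))
    where
    e = exponent m a
    h = suc (e ℕ.+ m)

  -- Probabilities as sums over lists of outcomes

  sumˡ : List A → (A → ℚ) → ℚ
  sumˡ []       f = 0ℚ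
  sumˡ (x ∷ xs) f = f x + sumˡ xs f

  sumˡ-cong : (xs : List A) {f g : A → ℚ} → f ≗ g → sumˡ xs f ≡ sumˡ xs g
  sumˡ-cong []       f≗g = refl
  sumˡ-cong (x ∷ xs) f≗g = cong₂ _+_ (f≗g x) (sumˡ-cong xs f≗g)

  sumˡ-*ˡ : ∀ c (xs : List A) (f : A → ℚ) → sumˡ xs (λ x → c * f x) ≡ c * sumˡ xs f
  sumˡ-*ˡ c []       f = sym (ℚ.*-zeroʳ c)
  sumˡ-*ˡ c (x ∷ xs) f = trans (cong (c * f x +_) (sumˡ-*ˡ c xs f))
    (sym (ℚ.*-distribˡ-+ c (f x) (sumˡ xs f)))

  sumˡ-++ : (xs ys : List A) (f : A → ℚ) → sumˡ (xs List.++ ys) f ≡ sumˡ xs f + sumˡ ys f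
  sumˡ-++ []       ys f = sym (ℚ.+-identityˡ _)
  sumˡ-++ (x ∷ xs) ys f = trans (cong (f x +_) (sumˡ-++ xs ys f)) (sym (ℚ.+-assoc (f x) _ _))

  sumˡ-map : (h : A → B) (xs : List A) (f : B → ℚ) → sumˡ (map h xs) f ≡ sumˡ xs (f ∘ h)
  sumˡ-map h []       f = refl
  sumˡ-map h (x ∷ xs) f = cong (f (h x) +_) (sumˡ-map h xs f)

  sumˡ-cartesianProductWith : (h : A → B → D) (xs : List A) (ys : List B) (f : D → ℚ) →
    sumˡ (cartesianProductWith h xs ys) f ≡ sumˡ xs (λ x → sumˡ ys (λ y → f (h x y)))
  sumˡ-cartesianProductWith h []       ys f = refl
  sumˡ-cartesianProductWith h (x ∷ xs) ys f = trans
    (sumˡ-++ (map (h x) ys) (cartesianProductWith h xs ys) f)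
    (cong₂ _+_ (sumˡ-map (h x) ys f) (sumˡ-cartesianProductWith h xs ys f))

  sumˡ-filter : {P : Pred A 0ℓ} (P? : Decidable P) (xs : List A) (f : A → ℚ) →
    sumˡ (filter P? xs) f ≡ sumˡ xs (λ x → f x * indicator (does (P? x)))
  sumˡ-filter P? []       f = refl
  sumˡ-filter P? (x ∷ xs) f with does (P? x)
  ... | true  = cong₂ _+_ (sym (ℚ.*-identityʳ (f x))) (sumˡ-filter P? xs f)
  ... | false = trans (sumˡ-filter P? xs f)
    (trans (sym (ℚ.+-identityˡ _)) (cong (_+ _) (sym (ℚ.*-zeroʳ (f x)))))

  module _ (p : ℝ) (k : ℕ) where
    private
      q = approx p k

    sumˡ-subsets : ∀ n (f : Subset n → ℚ) →
      sumˡ (subsets n) (λ S → approx (bernoulli p S) k * f S) ≡ 𝔼-subset n q f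
    sumˡ-subsets zero    f = trans (ℚ.+-identityʳ _) (ℚ.*-identityˡ (f []))
    sumˡ-subsets (suc n) f = trans
      (sumˡ-++ (map (true ∷_) (subsets n)) (map (false ∷_) (subsets n)) _)
      (cong₂ _+_ (half true q (λ S → refl)) (half false (1ℚ - q) (λ S → refl)))
      where
      half : ∀ b c → (∀ S → approx (bernoulli p (b ∷ S)) k ≡ c * approx (bernoulli p S) k) →
        sumˡ (map (b ∷_) (subsets n)) (λ S → approx (bernoulli p S) k * f S) ≡
        c * 𝔼-subset n q (λ S → f (b ∷ S))
      half b c eq = begin
        sumˡ (map (b ∷_) (subsets n)) (λ S → approx (bernoulli p S) k * f S)
          ≡⟨ sumˡ-map (b ∷_) (subsets n) _ ⟩
        sumˡ (subsets n) (λ S → approx (bernoulli p (b ∷ S)) k * f (b ∷ S))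
          ≡⟨ sumˡ-cong (subsets n) (λ S → trans (cong (_* f (b ∷ S)) (eq S))
               (ℚ.*-assoc c (approx (bernoulli p S) k) (f (b ∷ S)))) ⟩
        sumˡ (subsets n) (λ S → c * (approx (bernoulli p S) k * f (b ∷ S)))
          ≡⟨ sumˡ-*ˡ c (subsets n) _ ⟩
        c * sumˡ (subsets n) (λ S → approx (bernoulli p S) k * f (b ∷ S))
          ≡⟨ cong (c *_) (sumˡ-subsets n (λ S → f (b ∷ S))) ⟩
        c * 𝔼-subset n q (λ S → f (b ∷ S)) ∎
        where open ≡-Reasoning

    sumˡ-outcomes : 0ℚ ≤ q → q ≤ 1ℚ → ∀ n (f : Ω n → ℚ) →
      sumˡ (outcomes n) (λ Γ → approx (weight p Γ) k * f Γ) ≡ 𝔼 n q f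
    sumˡ-outcomes 0≤q q≤1 zero    f = trans (ℚ.+-identityʳ _) (ℚ.*-identityˡ (f ∅))
    sumˡ-outcomes 0≤q q≤1 (suc n) f = begin
      sumˡ (outcomes (suc n)) (λ Γ → approx (weight p Γ) k * f Γ)
        ≡⟨ sumˡ-cartesianProductWith _▹_ (outcomes n) (subsets n) _ ⟩
      sumˡ (outcomes n) (λ Γ → sumˡ (subsets n) (λ S → b S * w Γ * f (Γ ▹ S)))
        ≡⟨ sumˡ-cong (outcomes n) (λ Γ → trans
             (sumˡ-cong (subsets n) (λ S → commute (b S) (w Γ) (f (Γ ▹ S))))
             (trans (sumˡ-*ˡ (w Γ) (subsets n) _) (cong (w Γ *_) (sumˡ-subsets n _)))) ⟩
      sumˡ (outcomes n) (λ Γ → w Γ * 𝔼-subset n q (λ S → f (Γ ▹ S)))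
        ≡⟨ sumˡ-outcomes 0≤q q≤1 n _ ⟩
      𝔼 n q (λ Γ → 𝔼-subset n q (λ S → f (Γ ▹ S)))
        ≡⟨ 𝔼-subset-swap (𝔼-isExpectation 0≤q q≤1 n) n q (λ Γ S → f (Γ ▹ S)) ⟩
      𝔼-subset n q (λ S → 𝔼 n q (λ Γ → f (Γ ▹ S))) ∎
      where
      open ≡-Reasoning
      b = λ S → approx (bernoulli p S) k
      w = λ Γ → approx (weight p Γ) k
      commute : ∀ a b c → a * b * c ≡ b * (a * c)
      commute = solve 3 (λ a b c → a :* b :* c := b :* (a :* c)) refl

    approx-sumᴿ : (xs : List ℝ) → approx (sumᴿ xs) k ≡ sumˡ xs (λ x → approx x k)
    approx-sumᴿ []       = refl
    approx-sumᴿ (x ∷ xs) = cong (approx x k +_) (approx-sumᴿ xs)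

    -- The arithmetic of `ℝ` acts on each approximant separately, so the `k`-th approximant of a
    -- probability is the probability for the rational parameter `q`.
    approx-ℙ : 0ℚ ≤ q → q ≤ 1ℚ → ∀ n {E : Pred (Ω n) 0ℓ} (E? : Decidable E) →
      approx (ℙ n p E?) k ≡ 𝔼 n q (λ Γ → indicator (does (E? Γ)))
    approx-ℙ 0≤q q≤1 n E? = begin
      approx (ℙ n p E?) k
        ≡⟨ approx-sumᴿ (map (weight p) (filter E? (outcomes n))) ⟩
      sumˡ (map (weight p) (filter E? (outcomes n))) (λ x → approx x k)
        ≡⟨ sumˡ-map (weight p) (filter E? (outcomes n)) (λ x → approx x k) ⟩
      sumˡ (filter E? (outcomes n)) (λ Γ → approx (weight p Γ) k)
        ≡⟨ sumˡ-filter E? (outcomes n) (λ Γ → approx (weight p Γ) k) ⟩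
      sumˡ (outcomes n) (λ Γ → approx (weight p Γ) k * indicator (does (E? Γ)))
        ≡⟨ sumˡ-outcomes 0≤q q≤1 n _ ⟩
      𝔼 n q (λ Γ → indicator (does (E? Γ))) ∎
      where open ≡-Reasoning

  -- From witnesses to extensions in graphs

  lookup-require : (R : Vec Role n) (vs : Vec (Fin n) m) {b : Fin n} → All (_≢ b) vs →
    lookup (require R vs) b ≡ lookup R b
  lookup-require R []       []           = refl
  lookup-require R (v ∷ vs) {b} (v≢b ∷ vs≢b) = trans
    (lookup-require (R [ v ]≔ required true) vs vs≢b)
    (Vec.lookup∘update′ (≢-sym v≢b) R (required true))

  require-keeps : (R : Vec Role n) (vs : Vec (Fin n) m) {a : Fin n} →
    lookup R a ≡ required true → lookup (require R vs) a ≡ required true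
  require-keeps R []       eq = eq
  require-keeps R (v ∷ vs) {a} eq with a Fin.≟ v
  ... | yes refl = require-keeps (R [ a ]≔ required true) vs (Vec.lookup∘update a R (required true))
  ... | no a≢v   = require-keeps (R [ v ]≔ required true) vs
    (trans (Vec.lookup∘update′ a≢v R (required true)) eq)

  require-requires : (R : Vec Role n) (vs : Vec (Fin n) m) →
    All (λ a → lookup (require R vs) a ≡ required true) vs
  require-requires R []       = []
  require-requires R (v ∷ vs) =
    require-keeps (R [ v ]≔ required true) vs (Vec.lookup∘update v R (required true)) ∷
    require-requires (R [ v ]≔ required true) vs

  -- `b` keeps its role `required false`, because it does not occur in `as`; a candidate therefore
  -- differs from `b`.
  witness⇒extension : (Γ : Ω n) (b : Fin n) (as : Vec (Fin n) m) → All (_≢ b) as →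
    Witness (require (avoiding b) as) Γ → Extension (graph Γ) b as
  witness⇒extension Γ b as as≢b w = record
    { vertex    = vertex
    ; vertex∈V  = Subset.∈⊤
    ; vertex≢b  = λ { refl → candidate≢required (trans (sym is-candidate) b-required) }
    ; ¬adjacent = λ adj → subst T (complies b false b-required) adj
    ; adjacents = All.map (λ {a} eq → subst T (sym (complies a true eq)) _) (require-requires (avoiding b) as)
    }
    where
    open Witness w
    b-required : lookup (require (avoiding b) as) b ≡ required false
    b-required = trans (lookup-require (avoiding b) as as≢b)
      (Vec.lookup∘update b (replicate _ candidate) (required false))
    candidate≢required : ∀ {c} → candidate ≢ required c
    candidate≢required ()

  -- Either some failure is counted, or all extensions exist and the event occurs.
  1≤indicator+allFailures : ∀ m {E : Pred (Ω n) 0ℓ} (E? : Decidable E) →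
    (∀ Γ → Extendable m (graph Γ) → E Γ) →
    ∀ Γ → 1ℚ ≤ indicator (does (E? Γ)) + allFailures m Γ
  1≤indicator+allFailures m E? extendable⇒E Γ with 1≤allFailures⊎witness m Γ
  ... | inj₁ large = ≤-respˡ-≡ (ℚ.+-identityˡ 1ℚ) (ℚ.+-mono-≤ (0≤indicator (does (E? Γ))) large)
  ... | inj₂ w     = ≤-respˡ-≡ (ℚ.+-identityʳ 1ℚ) (ℚ.+-mono-≤
    (ℚ.≤-reflexive (cong indicator (sym (dec-true (E? Γ)
      (extendable⇒E Γ (λ b as as≢b → witness⇒extension Γ b as as≢b (w b as)))))))
    (0≤allFailures m Γ))

  -- Absolute values and signs of approximants

  indicator≤1 : ∀ b → indicator b ≤ 1ℚ
  indicator≤1 true  = ℚ.≤-refl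
  indicator≤1 false = 0≤1

  p≤∣p∣ : ∀ p → p ≤ ℚ.∣ p ∣
  p≤∣p∣ p with ℚ.≤-total 0ℚ p
  ... | inj₁ 0≤p = ℚ.≤-reflexive (sym (ℚ.0≤p⇒∣p∣≡p 0≤p))
  ... | inj₂ p≤0 = ℚ.≤-trans p≤0 (ℚ.0≤∣p∣ p)

  ∣p^n∣≡∣p∣^n : ∀ p n → ℚ.∣ p ^ n ∣ ≡ ℚ.∣ p ∣ ^ n
  ∣p^n∣≡∣p∣^n p zero    = refl
  ∣p^n∣≡∣p∣^n p (suc n) = trans (ℚ.∣p*q∣≡∣p∣*∣q∣ p (p ^ n)) (cong (ℚ.∣ p ∣ *_) (∣p^n∣≡∣p∣^n p n))

  -- The approximants of a nonnegative real may be negative, but not if they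
  -- have a large power.
  threshold : ∀ {c} → 1ℚ ≤ c → ∃[ η ] (0ℚ < η × (∀ q b → 1 ℕ.≤ b → 0ℚ ≤ q + η → 1ℚ ≤ c * q ^ b → 0ℚ ≤ q))
  threshold {c} 1≤c = η , 0<η , nonneg-q
    where
    0<c = ℚ.<-≤-trans (ℚ.positive⁻¹ 1ℚ) 1≤c
    instance
      c⁺ = ℚ.positive 0<c
      c≢0 = ℚ.pos⇒nonZero c
      c⁻¹⁺ = ℚ.1/pos⇒pos c
    -- For `q` between -η and 0, c|q|^b is at most cη = ½, against the lower bound 1.
    η = ℚ.1/ c * ½
    0<η : 0ℚ < η
    0<η = subst (_< η) (ℚ.*-zeroʳ (ℚ.1/ c)) (ℚ.*-monoʳ-<-pos (ℚ.1/ c) (ℚ.positive⁻¹ ½))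
    cη≡½ : c * η ≡ ½
    cη≡½ = trans (sym (ℚ.*-assoc c (ℚ.1/ c) ½)) (trans (cong (_* ½) (ℚ.*-inverseʳ c)) (ℚ.*-identityˡ ½))
    ½<1 : ½ < 1ℚ
    ½<1 = ℚ.*<* (ℤ.+<+ (ℕ.s≤s (ℕ.s≤s ℕ.z≤n)))
    η≤1 : η ≤ 1ℚ
    η≤1 = ℚ.≤-trans (≤-respˡ-≡ (ℚ.*-identityˡ η) (ℚ.*-monoʳ-≤-nonNeg η {{ℚ.nonNegative (ℚ.<⇒≤ 0<η)}} 1≤c))
      (ℚ.≤-trans (ℚ.≤-reflexive cη≡½) (ℚ.<⇒≤ ½<1))
    nonneg-q : ∀ q b → 1 ℕ.≤ b → 0ℚ ≤ q + η → 1ℚ ≤ c * q ^ b → 0ℚ ≤ q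
    nonneg-q q (suc b) _ 0≤q+η 1≤cq^b with ℚ.≤-total 0ℚ q
    ... | inj₁ 0≤q = 0≤q
    ... | inj₂ q≤0 = contradiction (ℚ.<-≤-trans ½<1 1≤½) (ℚ.<-irrefl refl)
      where
      0≤-q : 0ℚ ≤ ℚ.- q
      0≤-q = ℚ.neg-antimono-≤ q≤0
      ∣q∣≤η : ℚ.∣ q ∣ ≤ η
      ∣q∣≤η = ≤-respˡ-≡ (trans (sym (ℚ.0≤p⇒∣p∣≡p 0≤-q)) (ℚ.∣-p∣≡∣p∣ q))
        (≤-by-difference (q + η) 0≤q+η (solve 2 (λ q η → (:- q) :+ (q :+ η) := η) refl q η))
      1≤½ : 1ℚ ≤ ½
      1≤½ = begin
        1ℚ                        ≤⟨ 1≤cq^b ⟩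
        c * q ^ suc b             ≤⟨ ℚ.*-monoˡ-≤-nonNeg c {{ℚ.pos⇒nonNeg c}} (p≤∣p∣ (q ^ suc b)) ⟩
        c * ℚ.∣ q ^ suc b ∣       ≡⟨ cong (c *_) (∣p^n∣≡∣p∣^n q (suc b)) ⟩
        c * (ℚ.∣ q ∣ * ℚ.∣ q ∣ ^ b)
          ≤⟨ ℚ.*-monoˡ-≤-nonNeg c {{ℚ.pos⇒nonNeg c}}
               (*-mono-≤ (ℚ.0≤∣p∣ q) 0≤1 ∣q∣≤η (^-≤1 (ℚ.0≤∣p∣ q) (ℚ.≤-trans ∣q∣≤η η≤1) b)) ⟩
        c * (η * 1ℚ)              ≡⟨ cong (c *_) (ℚ.*-identityʳ η) ⟩
        c * η                     ≡⟨ cη≡½ ⟩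
        ½                         ∎
        where open ℚ.≤-Reasoning

  -- Middling functions

  approx-^ᴿ : ∀ x b k → approx (x ^ᴿ b) k ≡ approx x k ^ b
  approx-^ᴿ x zero    k = refl
  approx-^ᴿ x (suc b) k = cong (approx x k *_) (approx-^ᴿ x b k)

  -- The a in n^a x^b > 1 when log_n x > -a/b; zero for a nonnegative bound.
  deficit : ℚ → ℕ
  deficit q with ℚ.↥ q
  ... | ℤ.+ _      = 0
  ... | ℤ.-[1+ a ] = suc a

  1≤ι^ : ∀ {n} a → 1 ℕ.≤ n → 1ℚ ≤ ι n ^ a
  1≤ι^ a 1≤n = 1≤p^n (≤-respˡ-≡ ι-1 (ι-mono-≤ 1≤n)) a

  -- A nonnegative cut gives 1 ≤ n^a < x^b, so the power 0 of `n` suffices. The gap in the strict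
  -- inequality of reals yields a weak one for all late approximants.
  log⇒1≤ : ∀ {n} x q → 1 ℕ.≤ n → log n x q →
    Eventually (λ k → 1ℚ ≤ ι n ^ deficit q * approx x k ^ ℚ.↧ₙ q)
  log⇒1≤ {n} x q 1≤n log with ℚ.↥ q
  log⇒1≤ {n} x q 1≤n (ε , 0<ε , K , above) | ℤ.+ a = K , λ k K≤k → begin
    1ℚ                                         ≤⟨ 1≤ι^ a 1≤n ⟩
    ι n ^ a                                    ≡⟨ trans (sym (ι-fraction (n ℕ.^ a))) (ι-^ n a) ⟨
    (ℤ.+ (n ℕ.^ a)) ℚ./ 1                      ≤⟨ ≤-by-difference ε (ℚ.<⇒≤ 0<ε) refl ⟩
    (ℤ.+ (n ℕ.^ a)) ℚ./ 1 + ε                  ≤⟨ above k K≤k ⟩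
    approx (x ^ᴿ ℚ.↧ₙ q) k                     ≡⟨ approx-^ᴿ x (ℚ.↧ₙ q) k ⟩
    approx x k ^ ℚ.↧ₙ q                        ≡⟨ ℚ.*-identityˡ _ ⟨
    1ℚ * approx x k ^ ℚ.↧ₙ q                   ∎
    where open ℚ.≤-Reasoning
  log⇒1≤ {n} x q 1≤n (ε , 0<ε , K , above) | ℤ.-[1+ a ] = K , λ k K≤k → begin
    1ℚ                                         ≤⟨ ≤-by-difference ε (ℚ.<⇒≤ 0<ε) refl ⟩
    1ℚ + ε                                     ≤⟨ above k K≤k ⟩
    (ℤ.+ (n ℕ.^ suc a)) ℚ./ 1 * approx (x ^ᴿ ℚ.↧ₙ q) k
      ≡⟨ cong₂ _*_ (trans (sym (ι-fraction (n ℕ.^ suc a))) (ι-^ n (suc a))) (approx-^ᴿ x (ℚ.↧ₙ q) k) ⟩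
    ι n ^ suc a * approx x k ^ ℚ.↧ₙ q          ∎
    where open ℚ.≤-Reasoning

  -- For a cut -a/b, clearing denominators in -1/(w + 1) < -a/b gives (w + 1)a < b. A nonnegative
  -- cut has deficit 0.
  deficit-bound : ∀ w q → ℚ.- (ℤ.+ 1 ℚ./ suc w) < q → suc w ℕ.* deficit q ℕ.< ℚ.↧ₙ q
  deficit-bound w q@(ℚ.mkℚ (ℤ.+ _) b-1 _) _ = subst (ℕ._< suc b-1) (sym (ℕ.*-zeroʳ (suc w))) (ℕ.s≤s ℕ.z≤n)
  deficit-bound w q@(ℚ.mkℚ ℤ.-[1+ a ] b-1 _) -1/w<q =
    subst₂ ℕ._<_ (ℕ.*-comm (suc a) (suc w)) (ℕ.+-identityʳ (suc b-1))
      (ℤ.drop‿+<+ (ℤ.neg-cancel-< cleared))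
    where
    below : ℚᵘ.mkℚᵘ ℤ.-[1+ 0 ] w ℚᵘ.< ℚ.toℚᵘ q
    below = ℚᵘ.<-respˡ-≃
      (ℚᵘ.≃-trans (ℚ.toℚᵘ-homo‿- (ℤ.+ 1 ℚ./ suc w)) (ℚᵘ.-‿cong (ℚ.toℚᵘ-fromℚᵘ (ℚᵘ.mkℚᵘ (ℤ.+ 1) w))))
      (ℚ.toℚᵘ-mono-< -1/w<q)
    cleared : ℤ.- (ℤ.+ (1 ℕ.* suc b-1)) ℤ.< ℤ.- (ℤ.+ (suc a ℕ.* suc w))
    cleared = ℚᵘ.drop-*<* below

  Admissible : ℕ → ℕ → ℕ → ℚ → Set
  Admissible m a n q = 0ℚ ≤ q × q ≤ ½ × 1ℚ ≤ ι n ^ a * q ^ suc (m ℕ.* a)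

  -- For positive `w`, `cut-size` says that `cut` exceeds -1/w; in this form it also covers `w = 0`,
  -- where every cut satisfies it.
  record LogBound (w : ℕ) (p : ℕ → ℝ) : Set where
    field
      cut      : ℚ
      cut-size : w ℕ.* deficit cut ℕ.< ℚ.↧ₙ cut
      above    : Eventually (λ n → log n (p n) cut)

  middling⇒logBound : ∀ w p → Middling w p → LogBound w p
  middling⇒logBound zero    p ((_ , q , _ , ev) , _) = record
    { cut = q ; cut-size = ℕ.s≤s ℕ.z≤n ; above = ev }
  middling⇒logBound (suc w) p ((q , -1/w<q , ev) , _) = record
    { cut = q ; cut-size = deficit-bound w q -1/w<q ; above = ev }

  middling⇒admissible : ∀ w p → UnitIntervalValued p → Middling w p →
    ∃[ a ] Eventually (λ n → Eventually (λ k → Admissible w a n (approx (p n) k)))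
  middling⇒admissible w p unit middling =
    let L , logs     = above
        M , vanishes = proj₂ middling ½ (ℚ.positive⁻¹ ½)
    in a , 1 ℕ.⊔ (L ℕ.⊔ M) , λ n n≥ →
      let 1≤n = ℕ.m⊔n≤o⇒m≤o 1 (L ℕ.⊔ M) n≥
          L≤n = ℕ.m⊔n≤o⇒m≤o L M (ℕ.m⊔n≤o⇒n≤o 1 (L ℕ.⊔ M) n≥)
          M≤n = ℕ.m⊔n≤o⇒n≤o L M (ℕ.m⊔n≤o⇒n≤o 1 (L ℕ.⊔ M) n≥)
          K₁ , power          = log⇒1≤ (p n) cut 1≤n (logs n L≤n)
          ε , 0<ε , K₂ , small = proj₂ (vanishes n M≤n)
          η , 0<η , nonneg-q  = threshold (1≤ι^ a 1≤n)
          K₃ , nonneg-p       = proj₁ (unit n 1≤n) η 0<η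
      in K₁ ℕ.⊔ (K₂ ℕ.⊔ K₃) , λ k k≥ →
        let K₁≤k = ℕ.m⊔n≤o⇒m≤o K₁ (K₂ ℕ.⊔ K₃) k≥
            K₂≤k = ℕ.m⊔n≤o⇒m≤o K₂ K₃ (ℕ.m⊔n≤o⇒n≤o K₁ (K₂ ℕ.⊔ K₃) k≥)
            K₃≤k = ℕ.m⊔n≤o⇒n≤o K₂ K₃ (ℕ.m⊔n≤o⇒n≤o K₁ (K₂ ℕ.⊔ K₃) k≥)
            q = approx (p n) k
            0≤q = nonneg-q q b (ℕ.≤-trans (ℕ.s≤s ℕ.z≤n) cut-size) (nonneg-p k K₃≤k) (power k K₁≤k)
            q≤½ = ℚ.≤-trans (≤-by-difference ε (ℚ.<⇒≤ 0<ε) refl) (small k K₂≤k)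
        -- By `cut-size` the exponent `b` is at least `suc (w ℕ.* a)`; lowering it only enlarges the
        -- power, as `q` lies between 0 and 1.
        in 0≤q , q≤½ , ℚ.≤-trans (power k K₁≤k)
             (ℚ.*-monoˡ-≤-nonNeg (ι n ^ a) {{ℚ.nonNegative (ℚ.≤-trans 0≤1 (1≤ι^ a 1≤n))}}
               (^-antimonoʳ-≤ 0≤q (ℚ.≤-trans q≤½ ½≤1) cut-size))
    where
    open LogBound (middling⇒logBound w p middling)
    a = deficit cut
    b = ℚ.↧ₙ cut

  -- Passage to the limit

  module _ (m n : ℕ) {E : Pred (Ω n) 0ℓ} (E? : Decidable E)
    (extendable⇒E : ∀ Γ → Extendable m (graph Γ) → E Γ)
    {q : ℚ} (0≤q : 0ℚ ≤ q) (q≤1 : q ≤ 1ℚ) (ε : ℚ) where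
    private
      open ℚ.≤-Reasoning
      e = 𝔼-isExpectation 0≤q q≤1 n
      u = 𝔼 n q (λ Γ → indicator (does (E? Γ)))
      v = 𝔼 n q (allFailures m)

    -- The failures use up one half of `ε`; the other half remains as the gap that `_<ᴿ_` demands.
    𝔼-event-lower : v ≤ ½ * ε → 1ℚ - ε + ½ * ε ≤ u
    𝔼-event-lower v≤½ε = begin
      1ℚ - ε + ½ * ε     ≡⟨ solve 1 (λ ε → con 1ℚ :- ε :+ con ½ :* ε := con 1ℚ :- con ½ :* ε) refl ε ⟩
      1ℚ - ½ * ε         ≤⟨ ℚ.+-mono-≤ 1≤u+v (ℚ.neg-antimono-≤ v≤½ε) ⟩
      u + v - v          ≡⟨ solve 2 (λ u v → u :+ v :- v := u) refl u v ⟩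
      u                  ∎
      where
      1≤u+v : 1ℚ ≤ u + v
      1≤u+v = begin
        1ℚ                 ≡⟨ total e ⟨
        𝔼 n q (const 1ℚ)   ≤⟨ mono e (1≤indicator+allFailures m E? extendable⇒E) ⟩
        𝔼 n q (λ Γ → indicator (does (E? Γ)) + allFailures m Γ)
                           ≡⟨ additive e (λ Γ → indicator (does (E? Γ))) (allFailures m) ⟩
        u + v              ∎

    𝔼-event-upper : 0ℚ ≤ ½ * ε → u + ½ * ε ≤ 1ℚ + ε
    𝔼-event-upper 0≤½ε = ℚ.+-mono-≤
      (ℚ.≤-trans (mono e (λ Γ → indicator≤1 (does (E? Γ)))) (ℚ.≤-reflexive (total e)))
      (≤-by-difference (½ * ε) 0≤½ε (solve 1 (λ ε → con ½ :* ε :+ con ½ :* ε := ε) refl ε))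

  -- Both strict inequalities hold with the gap `½ε` at every admissible approximant.
  lim-ℙ≡1 : ∀ m a (p : ℕ → ℝ) {E : ∀ n → Pred (Ω n) 0ℓ} (E? : ∀ n → Decidable (E n)) →
    (∀ n Γ → Extendable m (graph Γ) → E n Γ) →
    Eventually (λ n → Eventually (λ k → Admissible m a n (approx (p n) k))) →
    lim (λ n → ℙ n (p n) (E? n)) 1ᴿ
  lim-ℙ≡1 m a p {E} E? extendable⇒E (N , admissible) ε 0<ε = N ℕ.⊔ M , λ n n≥ →
    let K , adm = admissible n (ℕ.m⊔n≤o⇒m≤o N M n≥)
        small = λ k (0≤q , q≤½ , 1≤) → proj₂ decay n (ℕ.m⊔n≤o⇒n≤o N M n≥) (approx (p n) k) 0≤q q≤½ 1≤
    in (½ε , 0<½ε , K , λ k K≤k → lower n k (adm k K≤k) (small k (adm k K≤k)))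
     , (½ε , 0<½ε , K , λ k K≤k → upper n k (adm k K≤k))
    where
    ½ε = ½ * ε
    0<½ε : 0ℚ < ½ε
    0<½ε = subst (_< ½ε) (ℚ.*-zeroʳ ½) (ℚ.*-monoʳ-<-pos ½ 0<ε)
    decay = 𝔼-allFailures-small m a ½ε 0<½ε
    M = proj₁ decay
    lower : ∀ n k → Admissible m a n (approx (p n) k) → 𝔼 n (approx (p n) k) (allFailures m) ≤ ½ε →
      1ℚ - ε + ½ε ≤ approx (ℙ n (p n) (E? n)) k
    lower n k (0≤q , q≤½ , _) small = ℚ.≤-trans
      (𝔼-event-lower m n (E? n) (extendable⇒E n) 0≤q (ℚ.≤-trans q≤½ ½≤1) ε small)
      (ℚ.≤-reflexive (sym (approx-ℙ (p n) k 0≤q (ℚ.≤-trans q≤½ ½≤1) n (E? n))))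
    upper : ∀ n k → Admissible m a n (approx (p n) k) →
      approx (ℙ n (p n) (E? n)) k + ½ε ≤ 1ℚ + ε
    upper n k (0≤q , q≤½ , _) = ℚ.≤-trans
      (ℚ.≤-reflexive (cong (_+ ½ε) (approx-ℙ (p n) k 0≤q (ℚ.≤-trans q≤½ ½≤1) n (E? n))))
      (𝔼-event-upper m n (E? n) (extendable⇒E n) 0≤q (ℚ.≤-trans q≤½ ½≤1) ε (ℚ.<⇒≤ 0<½ε))

open import Data.Nat.Base using (_*_)

proposition1p5 : (i : ℕ) (p : ℕ → ℝ) →
    UnitIntervalValued p →
    Middling (2 * i) p →
    lim (λ n → ℙ n (p n) (λ Γ → κ-𝔽₂ i (graph Γ) ≤∞? δ i (graph Γ))) 1ᴿ
proposition1p5 i p unit middling =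
  let a , admissible = middling⇒admissible (i ℕ.+ i) p unit
        -- `2 * i` unfolds to `i ℕ.+ (i ℕ.+ 0)`, whereas the antipodes need lists of length
        -- `i ℕ.+ i`.
        (subst (λ w → Middling w p) (cong (i ℕ.+_) (ℕ.+-identityʳ i)) middling)
  in lim-ℙ≡1 (i ℕ.+ i) a p (λ n Γ → κ-𝔽₂ i (graph Γ) ≤∞? δ i (graph Γ))
       (λ n Γ → extendable⇒κ≤δ (graph Γ) i) admissible
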